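{- Let $\mathscr{T}=\{a,b,c\}$, $I=\{1,2,3\}$, and let $\mathfrak{N}=\mathrm{TP}(\xi)$ be the simple system of triangle perspectives determined by one of the following fourteen triples: (i) $\xi(1,2)=\xi(2,3)=\xi(1,3)=\rho$; (ii) $\xi(1,2)=\xi(2,3)=\rho$, $\xi(1,3)=\mathrm{id}$; (iii) $\xi(1,2)=\rho$, $\xi(1,3)=\xi(2,3)=\mathrm{id}$; (iv) $\xi(1,2)=\xi(2,3)=\xi(3,1)=\rho$; (v) $\xi(1,2)=\xi(3,2)=\rho$, $\xi(1,3)=\mathrm{id}$; (vi) $\xi(1,2)=\sigma_a$, $\xi(1,3)=\sigma_c$, $\xi(2,3)=\sigma_b$; (vii) $\xi(1,2)=\sigma_a$, $\xi(2,3)=\sigma_c$, $\xi(1,3)=\mathrm{id}$; (viii) $\xi(1,2)=\sigma_a$, $\xi(2,3)=\rho$, $\xi(1,3)=\mathrm{id}$; (ix) $\xi(1,2)=\sigma_a$, $\xi(2,3)=\sigma_c$, $\xi(1,3)=\rho$; (x) $\xi(1,2)=\sigma_a$, $\xi(2,3)=\sigma_c$, $\xi(3,1)=\rho$; (xi) $\xi(1,2)=\xi(2,3)=\sigma_c$, $\xi(1,3)=\sigma_a$; (xii) $\xi(1,2)=\xi(2,3)=\sigma_c$, $\xi(1,3)=\rho$; (xiii) $\xi(1,2)=\xi(2,3)=\rho$, $\xi(1,3)=\sigma_c$; (xiv) $\xi(1,2)=\rho$, $\xi(2,3)=\rho^{ -1}$, $\xi(1,3)=\sigma_c$. Then the group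 $\mathfrak{G}$ of automorphisms of $\mathfrak{N}$ consists of exactly the maps $\beta\times\alpha$ with $\alpha\in S_I$ and $\beta\in S_{\mathscr{T}}$ such that: - cases (i), (ii), (iii): either $\alpha=\mathrm{id}$ and $\beta\in P$, or $\alpha=\sigma_{i_0}$ and $\beta=\sigma_x$ with $x\in\mathscr{T}$, where $i_0=2$, $i_0=2$, $i_0=3$ in cases (i), (ii), (iii) respectively; then $\mathfrak{G}\cong C_2\ltimes C_3=S_3$; - case (iv): either $\alpha\in R$ and $\beta\in P$, or $(\alpha,\beta)=(\sigma_i,\sigma_x)$ with $x\in\mathscr{T}$, $i\in I$; then $\mathfrak{G}\cong C_2\ltimes(C_3\oplus C_3)$; - case (v): $\alpha\in\{\mathrm{id},\sigma_2\}$ and $\beta\in P$; then $\mathfrak{G}\cong C_2\oplus C_3$; - case (vi): either $(\alpha,\beta)=(\varrho^m,\rho^m)$ with $m=0,1,2$, or $(\alpha,\beta)=(\sigma_i,\sigma_x)$ with $(x,i)\in\{(b,1),(c,2),(a,3)\}$; then $\mathfrak{G}\cong S_{\mathscr{T}}=S_3$; - cases (vii), (ix), (x), (xii), (xiii): either $(\alpha,\beta)=(\mathrm{id},\mathrm{id})$ or $(\alpha,\beta)=(\sigma_2,\sigma_{x_0})$, where $x_0=b,b,b,c,c$ in cases (vii), (ix), (x), (xii), (xiii) respectively; then $\mathfrak{G}\cong C_2$; - case (viii): $\alpha=\mathrm{id}$, $\beta=\mathrm{id}$; - cases (xi), (xiv): $\alpha\in\{\mathrm{id},\sigma_2\}$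 and $\beta=\mathrm{id}$; then $\mathfrak{G}\cong C_2$.
   Context: $S_{\mathscr{T}}$ and $S_I$ are the symmetric groups on $\mathscr{T}=\{a,b,c\}$ and $I=\{1,2,3\}$; $C_k$ is the cyclic group of order $k$. The permutation $\rho\in S_{\mathscr{T}}$ is given by $\rho(a)=b$, $\rho(b)=c$, $\rho(c)=a$; for $x\in\mathscr{T}$, $\sigma_x\in S_{\mathscr{T}}$ is the transposition fixing $x$ and interchanging the other two elements. $P$ is the group generated by $\rho$. For $i\in I$, $\sigma_i\in S_I$ is the transposition of the elements of $I\setminus\{i\}$; $\varrho\in S_I$ is the cycle $1\mapsto2\mapsto3\mapsto1$, and $R$ is the group generated by $\varrho$. Let $\xi\colon I\times I\to S_{\mathscr{T}}$ satisfy $\xi(i,i)=\mathrm{id}$ and $\xi(j,i)=\xi(i,j)^{ -1}$ for all $i,j\in I$. The simple system of triangle perspectives $\mathrm{TP}(\xi)$ is the incidence structure with the $15$ pairwise distinct points $q^a,q^b,q^c$; $a_i,b_i,c_i$ ($i\in I$); $q^{i,j}=q^{j,i}$ ($i\neq j$ in $I$), and the following lines (sets of points): $L=\{q^a,q^b,q^c\}$; $A_i=\{q^a,b_i,c_i\}$, $B_i=\{q^b,a_i,c_i\}$, $C_i=\{q^c,a_i,b_i\}$ for $i\in I$; $\{q^{i,j},x_i,(\xi(i,j)(x))_j\}$ for distinct $i,j\in I$ and $x\in\mathscr{T}$; and $\{q^{1,2},q^{1,3},q^{2,3}\}$. An automorphism is a permutation of the points mapping the set of lines onto itself. For $\alpha\in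 S_I$, $\beta\in S_{\mathscr{T}}$, the map $\beta\times\alpha$ on the points is given by $x_i\mapsto(\beta(x))_{\alpha(i)}$, $q^x\mapsto q^{\beta(x)}$, $q^{i,j}\mapsto q^{\alpha(i),\alpha(j)}$ for $x\in\mathscr{T}$ and $i,j\in I$. -}

module Defs where

open import Algebra.Bundles using (Group; AbelianGroup)
open import Algebra.Morphism.Structures using (IsGroupIsomorphism)
import Algebra.Construct.DirectProduct as DirectProduct
import Algebra.Definitions.RawMonoid as RawMonoidDefinitions
import Algebra.Properties.Group as GroupProperties
import Algebra.Properties.AbelianGroup as AbelianGroupProperties
open import Data.Empty using (⊥-elim; ⊥-elim-irr)
open import Data.Fin.Base using (Fin; toℕ; fromℕ<)
open import Data.Fin.Patterns using (0F; 1F)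
open import Data.Fin.Properties using (toℕ-injective; toℕ-fromℕ<; toℕ<n)
open import Data.Nat.Base using (ℕ; _+_; _∸_; _<_; z≤n; NonZero)
open import Data.Nat.DivMod using (_%_; m%n<n; %-distribˡ-+; m%n%n≡m%n; m<n⇒m%n≡m; n%n≡0)
open import Data.Nat.Properties using (+-assoc; +-comm; m+[n∸m]≡n; <⇒≤; ≤-<-trans)
open import Data.Product.Base using (Σ; ∃; ∃₂; _×_; _,_; proj₁; proj₂)
open import Data.Sum.Base using (_⊎_)
open import Data.Unit.Base using (⊤)
open import Function.Bundles using (_↔_; Inverse; mk↔ₛ′)
open import Function.Construct.Composition using (_↔-∘_)
open import Function.Construct.Identity using (↔-id)
open import Function.Construct.Symmetry using (↔-sym)
open import Level using (0ℓ)
open import Relation.Binary.PropositionalEquality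
  using (_≡_; _≢_; refl; sym; trans; cong; cong₂; isEquivalence; module ≡-Reasoning)
open import Relation.Unary using (Pred; ｛_｝; _∪_; _≐_)

open Inverse using (to; from)

infix 4 _≅_

_≅_ : Group 0ℓ 0ℓ → Group 0ℓ 0ℓ → Set
G ≅ H = ∃ (IsGroupIsomorphism (Group.rawGroup G) (Group.rawGroup H))

module _ (G : Group 0ℓ 0ℓ) where
  open Group G using (Carrier; _≈_; _∙_; ε; _⁻¹; rawMonoid)

  data Generated (g : Carrier) : Pred Carrier 0ℓ where
    generator : Generated g g
    unit      : Generated g ε
    product   : ∀ {x y} → Generated g x → Generated g y → Generated g (x ∙ y)
    inverse   : ∀ {x} → Generated g x → Generated g (x ⁻¹)
    respects  : ∀ {x y} → x ≈ y → Generated g x → Generated g y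

  power : Carrier → ℕ → Carrier
  power g n = n ⊗ g
    where open RawMonoidDefinitions rawMonoid renaming (_×_ to _⊗_)

-- Products are composites of functions: (f ∙ g)(x) = f(g(x)).
Sym : Set → Group 0ℓ 0ℓ
Sym A = record
  { Carrier = A ↔ A
  ; _≈_     = λ f g → ∀ x → to f x ≡ to g x
  ; _∙_     = _↔-∘_
  ; ε       = ↔-id A
  ; _⁻¹     = ↔-sym
  ; isGroup = record
    { isMonoid = record
      { isSemigroup = record
        { isMagma = record
          { isEquivalence = record
            { refl  = λ _ → refl
            ; sym   = λ e x → sym (e x)
            ; trans = λ e e′ x → trans (e x) (e′ x)
            }
          ; ∙-cong = λ {f} {f′} {g} {g′} e e′ x →
              trans (cong (to f) (e′ x)) (e (to g′ x))
          }
        ; assoc = λ _ _ _ _ → refl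
        }
      ; identity = (λ _ _ → refl) , (λ _ _ → refl)
      }
    ; inverse = (λ f _ → Inverse.strictlyInverseʳ f _)
              , (λ f _ → Inverse.strictlyInverseˡ f _)
    ; ⁻¹-cong = λ {f} {g} e x →
        trans (sym (Inverse.strictlyInverseʳ g _))
              (cong (from g) (trans (sym (e _)) (Inverse.strictlyInverseˡ f x)))
    }
  }

-- The cyclic group of order k, as Fin k with addition modulo k.
C : (k : ℕ) .{{_ : NonZero k}} → AbelianGroup 0ℓ 0ℓ
C k = record
  { Carrier = Fin k
  ; _≈_     = _≡_
  ; _∙_     = _⊕_
  ; ε       = mod 0
  ; _⁻¹     = neg
  ; isAbelianGroup = record
    { isGroup = record
      { isMonoid = record
        { isSemigroup = record
          { isMagma = record { isEquivalence = isEquivalence ; ∙-cong = cong₂ _⊕_ }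
          ; assoc   = assoc
          }
        ; identity = identityˡ , λ x → trans (comm x (mod 0)) (identityˡ x)
        }
      ; inverse = (λ x → trans (comm (neg x) x) (inverseʳ x)) , inverseʳ
      ; ⁻¹-cong = cong neg
      }
    ; comm = comm
    }
  }
  where
  open ≡-Reasoning

  mod : ℕ → Fin k
  mod n = fromℕ< (m%n<n n k)

  _⊕_ : Fin k → Fin k → Fin k
  x ⊕ y = mod (toℕ x + toℕ y)

  neg : Fin k → Fin k
  neg x = mod (k ∸ toℕ x)

  toℕ-mod : ∀ n → toℕ (mod n) ≡ n % k
  toℕ-mod n = toℕ-fromℕ< (m%n<n n k)

  mod-cong : ∀ {m n} → m % k ≡ n % k → mod m ≡ mod n
  mod-cong {m} {n} e = toℕ-injective (trans (toℕ-mod m) (trans e (sym (toℕ-mod n))))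

  mod-toℕ : ∀ x → mod (toℕ x) ≡ x
  mod-toℕ x = toℕ-injective (trans (toℕ-mod (toℕ x)) (m<n⇒m%n≡m (toℕ<n x)))

  %-absorbʳ : ∀ m n → (m + n % k) % k ≡ (m + n) % k
  %-absorbʳ m n = begin
    (m + n % k) % k           ≡⟨ %-distribˡ-+ m (n % k) k ⟩
    (m % k + n % k % k) % k   ≡⟨ cong (λ z → (m % k + z) % k) (m%n%n≡m%n n k) ⟩
    (m % k + n % k) % k       ≡⟨ sym (%-distribˡ-+ m n k) ⟩
    (m + n) % k               ∎

  ⊕-modʳ : ∀ x n → x ⊕ mod n ≡ mod (toℕ x + n)
  ⊕-modʳ x n = mod-cong
    (trans (cong (λ z → (toℕ x + z) % k) (toℕ-mod n)) (%-absorbʳ (toℕ x) n))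

  comm : ∀ x y → x ⊕ y ≡ y ⊕ x
  comm x y = cong mod (+-comm (toℕ x) (toℕ y))

  assoc : ∀ x y z → (x ⊕ y) ⊕ z ≡ x ⊕ (y ⊕ z)
  assoc x y z = begin
    mod (toℕ x + toℕ y) ⊕ z        ≡⟨ comm (mod (toℕ x + toℕ y)) z ⟩
    z ⊕ mod (toℕ x + toℕ y)        ≡⟨ ⊕-modʳ z (toℕ x + toℕ y) ⟩
    mod (toℕ z + (toℕ x + toℕ y))  ≡⟨ cong mod (+-comm (toℕ z) (toℕ x + toℕ y)) ⟩
    mod (toℕ x + toℕ y + toℕ z)    ≡⟨ cong mod (+-assoc (toℕ x) (toℕ y) (toℕ z)) ⟩
    mod (toℕ x + (toℕ y + toℕ z))  ≡⟨ sym (⊕-modʳ x (toℕ y + toℕ z)) ⟩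
    x ⊕ (y ⊕ z)                    ∎

  identityˡ : ∀ x → mod 0 ⊕ x ≡ x
  identityˡ x = begin
    mod 0 ⊕ x         ≡⟨ comm (mod 0) x ⟩
    x ⊕ mod 0         ≡⟨ ⊕-modʳ x 0 ⟩
    mod (toℕ x + 0)   ≡⟨ cong mod (+-comm (toℕ x) 0) ⟩
    mod (toℕ x)       ≡⟨ mod-toℕ x ⟩
    x                 ∎

  inverseʳ : ∀ x → x ⊕ neg x ≡ mod 0
  inverseʳ x = begin
    x ⊕ neg x                   ≡⟨ ⊕-modʳ x (k ∸ toℕ x) ⟩
    mod (toℕ x + (k ∸ toℕ x))   ≡⟨ cong mod (m+[n∸m]≡n (<⇒≤ (toℕ<n x))) ⟩
    mod k                       ≡⟨ mod-cong (trans (n%n≡0 k) (sym (m<n⇒m%n≡m (0<k x)))) ⟩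
    mod 0                       ∎
    where
    0<k : Fin k → 0 < k
    0<k y = ≤-<-trans z≤n (toℕ<n y)

infixl 6 _⊞_

_⊞_ : AbelianGroup 0ℓ 0ℓ → AbelianGroup 0ℓ 0ℓ → AbelianGroup 0ℓ 0ℓ
_⊞_ = DirectProduct.abelianGroup

record Action (H N : Group 0ℓ 0ℓ) : Set where
  private
    module H = Group H
    module N = Group N
  infixr 7.5 _▷_
  field
    _▷_    : H.Carrier → N.Carrier → N.Carrier
    ▷-cong : ∀ {h h′ n n′} → h H.≈ h′ → n N.≈ n′ → (h ▷ n) N.≈ (h′ ▷ n′)
    ▷-unit : ∀ n → (H.ε ▷ n) N.≈ n
    ▷-comp : ∀ h h′ n → ((h H.∙ h′) ▷ n) N.≈ (h ▷ h′ ▷ n)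
    ▷-homo : ∀ h n n′ → (h ▷ (n N.∙ n′)) N.≈ ((h ▷ n) N.∙ (h ▷ n′))

SemidirectProduct : (H N : Group 0ℓ 0ℓ) → Action H N → Group 0ℓ 0ℓ
SemidirectProduct H N φ = record
  { Carrier = H.Carrier × N.Carrier
  ; _≈_     = λ (h , n) (h′ , n′) → h H.≈ h′ × n N.≈ n′
  ; _∙_     = λ (h , n) (h′ , n′) → h H.∙ h′ , n N.∙ (h ▷ n′)
  ; ε       = H.ε , N.ε
  ; _⁻¹     = λ (h , n) → h H.⁻¹ , (h H.⁻¹ ▷ n N.⁻¹)
  ; isGroup = record
    { isMonoid = record
      { isSemigroup = record
        { isMagma = record
          { isEquivalence = record
            { refl  = H.refl , N.refl
            ; sym   = λ (e , e′) → H.sym e , N.sym e′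
            ; trans = λ (d , d′) (e , e′) → H.trans d e , N.trans d′ e′
            }
          ; ∙-cong = λ (d , d′) (e , e′) → H.∙-cong d e , N.∙-cong d′ (▷-cong d e′)
          }
        ; assoc = λ (h , n) (h′ , n′) (h″ , n″) →
            H.assoc h h′ h″ ,
            N.trans (N.∙-congˡ (▷-comp h h′ n″))
              (N.trans (N.assoc n (h ▷ n′) (h ▷ h′ ▷ n″))
                (N.∙-congˡ (N.sym (▷-homo h n′ (h′ ▷ n″)))))
        }
      ; identity =
          (λ (h , n) → H.identityˡ h , N.trans (N.identityˡ _) (▷-unit n))
        , (λ (h , n) → H.identityʳ h , N.trans (N.∙-congˡ (▷-ε h)) (N.identityʳ n))
      }
    ; inverse =
        (λ (h , n) → H.inverseˡ h ,
          N.trans (N.sym (▷-homo (h H.⁻¹) (n N.⁻¹) n))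
            (N.trans (▷-cong H.refl (N.inverseˡ n)) (▷-ε (h H.⁻¹))))
      , (λ (h , n) → H.inverseʳ h ,
          N.trans (N.∙-congˡ
            (N.trans (N.sym (▷-comp h (h H.⁻¹) (n N.⁻¹)))
              (N.trans (▷-cong (H.inverseʳ h) N.refl) (▷-unit (n N.⁻¹)))))
            (N.inverseʳ n))
    ; ⁻¹-cong = λ (e , e′) → H.⁻¹-cong e , ▷-cong (H.⁻¹-cong e) (N.⁻¹-cong e′)
    }
  }
  where
  module H = Group H
  module N = Group N
  open Action φ
  ▷-ε : ∀ h → (h ▷ N.ε) N.≈ N.ε
  ▷-ε h = GroupProperties.identityʳ-unique N (h ▷ N.ε) (h ▷ N.ε)
    (N.trans (N.sym (▷-homo h N.ε N.ε)) (▷-cong H.refl (N.identityˡ N.ε)))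

C₂ C₃ : AbelianGroup 0ℓ 0ℓ
C₂ = C 2
C₃ = C 3

inversion : (N : AbelianGroup 0ℓ 0ℓ) → Action (AbelianGroup.group C₂) (AbelianGroup.group N)
inversion N = record
  { _▷_    = act
  ; ▷-cong = λ { {0F} refl e → e ; {1F} refl e → ⁻¹-cong e }
  ; ▷-unit = λ _ → N-refl
  ; ▷-comp = λ
      { 0F 0F n → N-refl
      ; 0F 1F n → N-refl
      ; 1F 0F n → N-refl
      ; 1F 1F n → N-sym (⁻¹-involutive n)
      }
  ; ▷-homo = λ
      { 0F n n′ → N-refl
      ; 1F n n′ → N-sym (⁻¹-∙-comm n n′)
      }
  }
  where
  open AbelianGroup N renaming (refl to N-refl; sym to N-sym)
  open AbelianGroupProperties N using (⁻¹-∙-comm; ⁻¹-involutive)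
  act : Fin 2 → Carrier → Carrier
  act 0F n = n
  act 1F n = n ⁻¹

-- The semidirect product in which the generator of C₂ inverts every element
-- of N.
C₂⋉_ : AbelianGroup 0ℓ 0ℓ → Group 0ℓ 0ℓ
C₂⋉ N = SemidirectProduct (AbelianGroup.group C₂) (AbelianGroup.group N) (inversion N)

-- The lines are the sets ⟦ l ⟧; distinct names may denote the same set, so lines
-- are compared extensionally, by _≐_.
record IncidenceStructure : Set₁ where
  field
    Point    : Set
    LineName : Set
    ⟦_⟧      : LineName → Pred Point 0ℓ

image : {A : Set} → A ↔ A → Pred A 0ℓ → Pred A 0ℓ
image f S y = ∃ λ x → S x × to f x ≡ y

module _ (𝔑 : IncidenceStructure) where
  open IncidenceStructure 𝔑

  record IsAutomorphism (f : Point ↔ Point) : Set where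
    field
      into : ∀ l → ∃ λ l′ → image f ⟦ l ⟧ ≐ ⟦ l′ ⟧
      onto : ∀ l′ → ∃ λ l → image f ⟦ l ⟧ ≐ ⟦ l′ ⟧

  private
    module S = Group (Sym Point)
    open IsAutomorphism

    aut-id : IsAutomorphism (↔-id Point)
    aut-id = record { into = λ l → l , id-≐ l ; onto = λ l → l , id-≐ l }
      where
      id-≐ : ∀ l → image (↔-id Point) ⟦ l ⟧ ≐ ⟦ l ⟧
      id-≐ l = (λ { (_ , s , refl) → s }) , (λ s → _ , s , refl)

    aut-∘ : ∀ f g → IsAutomorphism f → IsAutomorphism g → IsAutomorphism (f ↔-∘ g)
    aut-∘ f g F G = record
      { into = λ l → let l₁ , e₁ = into G l ; l₂ , e₂ = into F l₁ in
          l₂ , ∘-≐ l l₁ l₂ e₁ e₂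
      ; onto = λ l₂ → let l₁ , e₂ = onto F l₂ ; l , e₁ = onto G l₁ in
          l , ∘-≐ l l₁ l₂ e₁ e₂
      }
      where
      ∘-≐ : ∀ l l₁ l₂ → image g ⟦ l ⟧ ≐ ⟦ l₁ ⟧ → image f ⟦ l₁ ⟧ ≐ ⟦ l₂ ⟧ →
            image (f ↔-∘ g) ⟦ l ⟧ ≐ ⟦ l₂ ⟧
      ∘-≐ l l₁ l₂ (p , q) (r , s) =
          (λ { (x , x∈l , refl) → r (to g x , p (x , x∈l , refl) , refl) })
        , λ z∈l₂ → let y , y∈l₁ , fy≡z = s z∈l₂ ; x , x∈l , gx≡y = q y∈l₁ in
            x , x∈l , trans (cong (to f) gx≡y) fy≡z

    aut-⁻¹ : ∀ f → IsAutomorphism f → IsAutomorphism (↔-sym f)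
    aut-⁻¹ f F = record
      { into = λ l → let l′ , e = onto F l in l′ , ⁻¹-≐ l l′ e
      ; onto = λ l′ → let l , e = into F l′ in l , ⁻¹-≐ l l′ e
      }
      where
      ⁻¹-≐ : ∀ l l′ → image f ⟦ l′ ⟧ ≐ ⟦ l ⟧ → image (↔-sym f) ⟦ l ⟧ ≐ ⟦ l′ ⟧
      ⁻¹-≐ l l′ (p , q) =
          (λ { (x , x∈l , refl) → let y , y∈l′ , fy≡x = q x∈l in
               ∈-resp l′ (trans (sym (Inverse.strictlyInverseʳ f y)) (cong (from f) fy≡x)) y∈l′ })
        , λ {y} y∈l′ → to f y , p (y , y∈l′ , refl) , Inverse.strictlyInverseʳ f y
        where
        ∈-resp : ∀ m {x y} → x ≡ y → ⟦ m ⟧ x → ⟦ m ⟧ y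
        ∈-resp m refl s = s

  Aut : Group 0ℓ 0ℓ
  Aut = record
    { Carrier = Σ (Point ↔ Point) IsAutomorphism
    ; _≈_     = λ f g → proj₁ f S.≈ proj₁ g
    ; _∙_     = λ (f , F) (g , G) → (f ↔-∘ g) , aut-∘ f g F G
    ; ε       = ↔-id Point , aut-id
    ; _⁻¹     = λ (f , F) → ↔-sym f , aut-⁻¹ f F
    ; isGroup = record
      { isMonoid = record
        { isSemigroup = record
          { isMagma = record
            { isEquivalence = record
              { refl  = λ {f} → S.refl {proj₁ f}
              ; sym   = λ {f} {g} → S.sym {proj₁ f} {proj₁ g}
              ; trans = λ {f} {g} {h} → S.trans {proj₁ f} {proj₁ g} {proj₁ h}
              }
            ; ∙-cong = λ {f} {f′} {g} {g′} →
                S.∙-cong {proj₁ f} {proj₁ f′} {proj₁ g} {proj₁ g′}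
            }
          ; assoc = λ (f , _) (g , _) (h , _) → S.assoc f g h
          }
        ; identity = (λ (f , _) → S.identityˡ f) , (λ (f , _) → S.identityʳ f)
        }
      ; inverse = (λ (f , _) → S.inverseˡ f) , (λ (f , _) → S.inverseʳ f)
      ; ⁻¹-cong = λ {f} {g} → S.⁻¹-cong {proj₁ f} {proj₁ g}
      }
    }

data 𝒯 : Set where
  a b c : 𝒯

data I : Set where
  𝟏 𝟐 𝟑 : I

S𝒯 SI : Group 0ℓ 0ℓ
S𝒯 = Sym 𝒯
SI = Sym I

open Group S𝒯 public using () renaming (Carrier to Perm𝒯; _≈_ to _≈𝒯_; ε to id𝒯; _⁻¹ to _⁻¹𝒯)
open Group SI public using () renaming (Carrier to PermI; _≈_ to _≈I_; ε to idI)

ρ : Perm𝒯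
ρ = mk↔ₛ′
  (λ { a → b ; b → c ; c → a })
  (λ { a → c ; b → a ; c → b })
  (λ { a → refl ; b → refl ; c → refl })
  (λ { a → refl ; b → refl ; c → refl })

σ : 𝒯 → Perm𝒯
σ x = mk↔ₛ′ (swap x) (swap x) (swap-swap x) (swap-swap x)
  where
  swap : 𝒯 → 𝒯 → 𝒯
  swap a = λ { a → a ; b → c ; c → b }
  swap b = λ { a → c ; b → b ; c → a }
  swap c = λ { a → b ; b → a ; c → c }
  swap-swap : ∀ x y → swap x (swap x y) ≡ y
  swap-swap a = λ { a → refl ; b → refl ; c → refl }
  swap-swap b = λ { a → refl ; b → refl ; c → refl }
  swap-swap c = λ { a → refl ; b → refl ; c → refl }

ϱ : PermI
ϱ = mk↔ₛ′
  (λ { 𝟏 → 𝟐 ; 𝟐 → 𝟑 ; 𝟑 → 𝟏 })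
  (λ { 𝟏 → 𝟑 ; 𝟐 → 𝟏 ; 𝟑 → 𝟐 })
  (λ { 𝟏 → refl ; 𝟐 → refl ; 𝟑 → refl })
  (λ { 𝟏 → refl ; 𝟐 → refl ; 𝟑 → refl })

σI : I → PermI
σI i = mk↔ₛ′ (swap i) (swap i) (swap-swap i) (swap-swap i)
  where
  swap : I → I → I
  swap 𝟏 = λ { 𝟏 → 𝟏 ; 𝟐 → 𝟑 ; 𝟑 → 𝟐 }
  swap 𝟐 = λ { 𝟏 → 𝟑 ; 𝟐 → 𝟐 ; 𝟑 → 𝟏 }
  swap 𝟑 = λ { 𝟏 → 𝟐 ; 𝟐 → 𝟏 ; 𝟑 → 𝟑 }
  swap-swap : ∀ i j → swap i (swap i j) ≡ j
  swap-swap 𝟏 = λ { 𝟏 → refl ; 𝟐 → refl ; 𝟑 → refl }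
  swap-swap 𝟐 = λ { 𝟏 → refl ; 𝟐 → refl ; 𝟑 → refl }
  swap-swap 𝟑 = λ { 𝟏 → refl ; 𝟐 → refl ; 𝟑 → refl }

P : Pred Perm𝒯 0ℓ
P = Generated S𝒯 ρ

R : Pred PermI 0ℓ
R = Generated SI ϱ

-- q^ x is qˣ and x at i is xᵢ; the points q^{i,j} = q^{j,i} are the last three
-- constructors, and q below writes them in terms of i and j.
data TPPoint : Set where
  q^          : 𝒯 → TPPoint
  _at_        : 𝒯 → I → TPPoint
  q₁₂ q₁₃ q₂₃ : TPPoint

q : (i j : I) → .(i ≢ j) → TPPoint
q 𝟏 𝟏 i≢j = ⊥-elim-irr (i≢j refl)
q 𝟏 𝟐 _   = q₁₂
q 𝟏 𝟑 _   = q₁₃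
q 𝟐 𝟏 _   = q₁₂
q 𝟐 𝟐 i≢j = ⊥-elim-irr (i≢j refl)
q 𝟐 𝟑 _   = q₂₃
q 𝟑 𝟏 _   = q₁₃
q 𝟑 𝟐 _   = q₂₃
q 𝟑 𝟑 i≢j = ⊥-elim-irr (i≢j refl)

record Perspectives : Set where
  field
    ξ          : I → I → Perm𝒯
    ξ-diagonal : ∀ i → ξ i i ≈𝒯 id𝒯
    ξ-inverse  : ∀ i j → ξ j i ≈𝒯 (ξ i j) ⁻¹𝒯

data TPLine : Set where
  L Q                     : TPLine
  A-line B-line C-line    : I → TPLine
  perspective             : (i j : I) → .(i ≢ j) → 𝒯 → TPLine

⁅_,_,_⁆ : TPPoint → TPPoint → TPPoint → Pred TPPoint 0ℓ
⁅ p , p′ , p″ ⁆ = ｛ p ｝ ∪ ｛ p′ ｝ ∪ ｛ p″ ｝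

TP : Perspectives → IncidenceStructure
TP Ξ = record { Point = TPPoint ; LineName = TPLine ; ⟦_⟧ = points }
  where
  open Perspectives Ξ
  points : TPLine → Pred TPPoint 0ℓ
  points L                       = ⁅ q^ a , q^ b , q^ c ⁆
  points Q                       = ⁅ q₁₂ , q₁₃ , q₂₃ ⁆
  points (A-line i)              = ⁅ q^ a , b at i , c at i ⁆
  points (B-line i)              = ⁅ q^ b , a at i , c at i ⁆
  points (C-line i)              = ⁅ q^ c , a at i , b at i ⁆
  points (perspective i j i≢j x) = ⁅ q i j i≢j , x at i , to (ξ i j) x at j ⁆

private
  inj : (α : PermI) {i j : I} → i ≢ j → to α i ≢ to α j
  inj α {i} {j} i≢j e = i≢j (trans (sym (Inverse.strictlyInverseʳ α i))
    (trans (cong (from α) e) (Inverse.strictlyInverseʳ α j)))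

act : Perm𝒯 → PermI → TPPoint → TPPoint
act β α (q^ x)   = q^ (to β x)
act β α (x at i) = to β x at to α i
act β α q₁₂      = q (to α 𝟏) (to α 𝟐) (inj α {𝟏} {𝟐} (λ ()))
act β α q₁₃      = q (to α 𝟏) (to α 𝟑) (inj α {𝟏} {𝟑} (λ ()))
act β α q₂₃      = q (to α 𝟐) (to α 𝟑) (inj α {𝟐} {𝟑} (λ ()))

private
  q-sym : ∀ i j .(i≢j : i ≢ j) .(j≢i : j ≢ i) → q i j i≢j ≡ q j i j≢i
  q-sym 𝟏 𝟏 i≢j _ = ⊥-elim-irr (i≢j refl)
  q-sym 𝟏 𝟐 _ _   = refl
  q-sym 𝟏 𝟑 _ _   = refl
  q-sym 𝟐 𝟏 _ _   = refl
  q-sym 𝟐 𝟐 i≢j _ = ⊥-elim-irr (i≢j refl)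
  q-sym 𝟐 𝟑 _ _   = refl
  q-sym 𝟑 𝟏 _ _   = refl
  q-sym 𝟑 𝟐 _ _   = refl
  q-sym 𝟑 𝟑 i≢j _ = ⊥-elim-irr (i≢j refl)

  q-cong : ∀ {i i′ j j′} → i ≡ i′ → j ≡ j′ →
           .(e : i ≢ j) .(e′ : i′ ≢ j′) → q i j e ≡ q i′ j′ e′
  q-cong refl refl _ _ = refl

act-q : ∀ β α i j (i≢j : i ≢ j) →
        act β α (q i j i≢j) ≡ q (to α i) (to α j) (inj α i≢j)
act-q β α 𝟏 𝟏 i≢j = ⊥-elim (i≢j refl)
act-q β α 𝟏 𝟐 i≢j = refl
act-q β α 𝟏 𝟑 i≢j = refl
act-q β α 𝟐 𝟏 i≢j = q-sym (to α 𝟏) (to α 𝟐) _ _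
act-q β α 𝟐 𝟐 i≢j = ⊥-elim (i≢j refl)
act-q β α 𝟐 𝟑 i≢j = refl
act-q β α 𝟑 𝟏 i≢j = q-sym (to α 𝟏) (to α 𝟑) _ _
act-q β α 𝟑 𝟐 i≢j = q-sym (to α 𝟐) (to α 𝟑) _ _
act-q β α 𝟑 𝟑 i≢j = ⊥-elim (i≢j refl)

private
  act-inverse : ∀ β β′ α α′ → (∀ x → to β (to β′ x) ≡ x) → (∀ i → to α (to α′ i) ≡ i) →
                ∀ p → act β α (act β′ α′ p) ≡ p
  act-inverse β β′ α α′ e e′ = inverse-at
    where
    on-q : ∀ i j (i≢j : i ≢ j) →
           act β α (q (to α′ i) (to α′ j) (inj α′ i≢j)) ≡ q i j i≢j
    on-q i j i≢j = trans (act-q β α (to α′ i) (to α′ j) (inj α′ i≢j))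
                         (q-cong (e′ i) (e′ j) _ i≢j)
    inverse-at : ∀ p → act β α (act β′ α′ p) ≡ p
    inverse-at (q^ x)   = cong q^ (e x)
    inverse-at (x at i) = cong₂ _at_ (e x) (e′ i)
    inverse-at q₁₂      = on-q 𝟏 𝟐 (λ ())
    inverse-at q₁₃      = on-q 𝟏 𝟑 (λ ())
    inverse-at q₂₃      = on-q 𝟐 𝟑 (λ ())

infix 7 _⊠_

-- The map β × α; act-q is its defining formula q^{i,j} ↦ q^{α(i),α(j)}.
_⊠_ : Perm𝒯 → PermI → TPPoint ↔ TPPoint
β ⊠ α = mk↔ₛ′ (act β α) (act (↔-sym β) (↔-sym α))
  (act-inverse β (↔-sym β) α (↔-sym α) (Inverse.strictlyInverseˡ β) (Inverse.strictlyInverseˡ α))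
  (act-inverse (↔-sym β) β (↔-sym α) α (Inverse.strictlyInverseʳ β) (Inverse.strictlyInverseʳ α))

data Case : Set where
  ⟨i⟩ ⟨ii⟩ ⟨iii⟩ ⟨iv⟩ ⟨v⟩ ⟨vi⟩ ⟨vii⟩ ⟨viii⟩ ⟨ix⟩ ⟨x⟩ ⟨xi⟩ ⟨xii⟩ ⟨xiii⟩ ⟨xiv⟩ : Case

IsCase : Case → Perspectives → Set
IsCase κ Ξ = triple κ
  where
  open Perspectives Ξ
  triple : Case → Set
  triple ⟨i⟩    = ξ 𝟏 𝟐 ≈𝒯 ρ   × ξ 𝟐 𝟑 ≈𝒯 ρ      × ξ 𝟏 𝟑 ≈𝒯 ρ
  triple ⟨ii⟩   = ξ 𝟏 𝟐 ≈𝒯 ρ   × ξ 𝟐 𝟑 ≈𝒯 ρ      × ξ 𝟏 𝟑 ≈𝒯 id𝒯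
  triple ⟨iii⟩  = ξ 𝟏 𝟐 ≈𝒯 ρ   × ξ 𝟏 𝟑 ≈𝒯 id𝒯    × ξ 𝟐 𝟑 ≈𝒯 id𝒯
  triple ⟨iv⟩   = ξ 𝟏 𝟐 ≈𝒯 ρ   × ξ 𝟐 𝟑 ≈𝒯 ρ      × ξ 𝟑 𝟏 ≈𝒯 ρ
  triple ⟨v⟩    = ξ 𝟏 𝟐 ≈𝒯 ρ   × ξ 𝟑 𝟐 ≈𝒯 ρ      × ξ 𝟏 𝟑 ≈𝒯 id𝒯
  triple ⟨vi⟩   = ξ 𝟏 𝟐 ≈𝒯 σ a × ξ 𝟏 𝟑 ≈𝒯 σ c    × ξ 𝟐 𝟑 ≈𝒯 σ b
  triple ⟨vii⟩  = ξ 𝟏 𝟐 ≈𝒯 σ a × ξ 𝟐 𝟑 ≈𝒯 σ c    × ξ 𝟏 𝟑 ≈𝒯 id𝒯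
  triple ⟨viii⟩ = ξ 𝟏 𝟐 ≈𝒯 σ a × ξ 𝟐 𝟑 ≈𝒯 ρ      × ξ 𝟏 𝟑 ≈𝒯 id𝒯
  triple ⟨ix⟩   = ξ 𝟏 𝟐 ≈𝒯 σ a × ξ 𝟐 𝟑 ≈𝒯 σ c    × ξ 𝟏 𝟑 ≈𝒯 ρ
  triple ⟨x⟩    = ξ 𝟏 𝟐 ≈𝒯 σ a × ξ 𝟐 𝟑 ≈𝒯 σ c    × ξ 𝟑 𝟏 ≈𝒯 ρ
  triple ⟨xi⟩   = ξ 𝟏 𝟐 ≈𝒯 σ c × ξ 𝟐 𝟑 ≈𝒯 σ c    × ξ 𝟏 𝟑 ≈𝒯 σ a
  triple ⟨xii⟩  = ξ 𝟏 𝟐 ≈𝒯 σ c × ξ 𝟐 𝟑 ≈𝒯 σ c    × ξ 𝟏 𝟑 ≈𝒯 ρ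
  triple ⟨xiii⟩ = ξ 𝟏 𝟐 ≈𝒯 ρ   × ξ 𝟐 𝟑 ≈𝒯 ρ      × ξ 𝟏 𝟑 ≈𝒯 σ c
  triple ⟨xiv⟩  = ξ 𝟏 𝟐 ≈𝒯 ρ   × ξ 𝟐 𝟑 ≈𝒯 ρ ⁻¹𝒯  × ξ 𝟏 𝟑 ≈𝒯 σ c

Listed : Case → PermI → Perm𝒯 → Set
Listed κ α β = listed κ
  where
  dihedral : I → Set
  dihedral i₀ = (α ≈I idI × P β) ⊎ (α ≈I σI i₀ × ∃ λ x → β ≈𝒯 σ x)

  involutive : 𝒯 → Set
  involutive x₀ = (α ≈I idI × β ≈𝒯 id𝒯) ⊎ (α ≈I σI 𝟐 × β ≈𝒯 σ x₀)

  σσ : I → 𝒯 → Set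
  σσ i x = α ≈I σI i × β ≈𝒯 σ x

  listed : Case → Set
  listed ⟨i⟩    = dihedral 𝟐
  listed ⟨ii⟩   = dihedral 𝟐
  listed ⟨iii⟩  = dihedral 𝟑
  listed ⟨iv⟩   = (R α × P β) ⊎ ∃₂ σσ
  listed ⟨v⟩    = (α ≈I idI ⊎ α ≈I σI 𝟐) × P β
  listed ⟨vi⟩   = (∃ λ (m : Fin 3) → α ≈I power SI ϱ (toℕ m) × β ≈𝒯 power S𝒯 ρ (toℕ m))
                ⊎ (σσ 𝟏 b ⊎ σσ 𝟐 c ⊎ σσ 𝟑 a)
  listed ⟨vii⟩  = involutive b
  listed ⟨viii⟩ = α ≈I idI × β ≈𝒯 id𝒯
  listed ⟨ix⟩   = involutive b
  listed ⟨x⟩    = involutive b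
  listed ⟨xi⟩   = (α ≈I idI ⊎ α ≈I σI 𝟐) × β ≈𝒯 id𝒯
  listed ⟨xii⟩  = involutive c
  listed ⟨xiii⟩ = involutive c
  listed ⟨xiv⟩  = (α ≈I idI ⊎ α ≈I σI 𝟐) × β ≈𝒯 id𝒯

-- S₃ is the symmetric group of I = {1, 2, 3}.
IsomorphismType : Case → Group 0ℓ 0ℓ → Set
IsomorphismType κ 𝔊 = type κ
  where
  S₃ : Group 0ℓ 0ℓ
  S₃ = SI

  ≅S₃ ≅C₂ : Set
  ≅S₃ = 𝔊 ≅ C₂⋉ C₃ × C₂⋉ C₃ ≅ S₃
  ≅C₂ = 𝔊 ≅ AbelianGroup.group C₂

  type : Case → Set
  type ⟨i⟩    = ≅S₃
  type ⟨ii⟩   = ≅S₃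
  type ⟨iii⟩  = ≅S₃
  type ⟨iv⟩   = 𝔊 ≅ C₂⋉ (C₃ ⊞ C₃)
  type ⟨v⟩    = 𝔊 ≅ AbelianGroup.group (C₂ ⊞ C₃)
  type ⟨vi⟩   = 𝔊 ≅ S𝒯 × S𝒯 ≅ S₃
  type ⟨vii⟩  = ≅C₂
  type ⟨viii⟩ = ⊤
  type ⟨ix⟩   = ≅C₂
  type ⟨x⟩    = ≅C₂
  type ⟨xi⟩   = ≅C₂
  type ⟨xii⟩  = ≅C₂
  type ⟨xiii⟩ = ≅C₂
  type ⟨xiv⟩  = ≅C₂

{-# OPTIONS --safe #-}

-- A map β × α with ξ(α i, α j) β = β ξ(i, j) maps lines to lines, so the listed
-- maps are automorphisms. Conversely, an automorphism is determined by the images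
-- of the axis L, of the three triangles aᵢbᵢcᵢ, and of the centres q^{i,j}, which
-- are again a line, three triangles whose sides pass through its points, and
-- collinear centres of the perspectives ξ between these triangles. Such configurations are few enough to be
-- enumerated in each of the fourteen systems, and each of them is the image of
-- the original one under a listed map. These maps form the image of a faithful
-- representation of the claimed abstract group.
module Submission where

open import Defs
open import Algebra.Bundles using (Group; AbelianGroup)
open import Algebra.Morphism.Structures using (IsGroupIsomorphism)
import Algebra.Morphism.Construct.Composition as Composition
import Algebra.Properties.Group as GroupProperties
open import Data.Bool.Base using (true)
open import Data.Empty using (⊥-elim-irr)
open import Data.Fin.Base using (Fin; toℕ)
open import Data.Fin.Patterns using (0F; 1F; 2F)
import Data.Fin.Properties as Fin
open import Data.List.Base using (List; []; _∷_; [_]; map)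
import Data.List.Properties as List
open import Data.List.Membership.Propositional using (_∈_)
import Data.List.Membership.DecPropositional as DecMembership
import Data.List.Relation.Unary.All as All
open import Data.List.Relation.Unary.Any using (here; there)
open import Data.Nat.Base using (zero; suc)
open import Data.Product.Base using (∃; ∃₂; _×_; _,_; proj₁; proj₂; uncurry)
import Data.Product.Properties as Product
open import Data.Sum.Base using (_⊎_; inj₁; inj₂)
import Data.Sum.Properties as Sum
open import Function.Base using (_∘_; id)
open import Function.Bundles using (_↔_; _⇔_; Inverse; mk⇔; mk↔ₛ′)
open import Function.Construct.Composition using (_↔-∘_)
open import Function.Construct.Symmetry using (↔-sym)
open import Level using (0ℓ)
open import Relation.Binary.Definitions using (DecidableEquality)
open import Relation.Binary.PropositionalEquality
  using (_≡_; _≢_; refl; sym; trans; cong; cong₂; subst; module ≡-Reasoning)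
open import Relation.Nullary using (Dec; yes; no; does; contradiction)
open import Relation.Nullary.Recomputable using (¬-recompute)
open import Relation.Nullary.Decidable using (map′; _×-dec_; _→-dec_; ¬?)
open import Relation.Unary using (_≐_)

open Inverse using (to; from)

-- Groups

module _ {G H : Group 0ℓ 0ℓ} where
  private
    module G = Group G
    module H = Group H

  -- A bijection that respects products suffices: `φ G.ε` is idempotent, hence the unit, and
  -- `φ (x G.⁻¹)` is a left inverse of `φ x`.
  mk-≅ : (φ : G.Carrier → H.Carrier) →
         (∀ {x y} → x G.≈ y → φ x H.≈ φ y) →
         (∀ x y → φ (x G.∙ y) H.≈ (φ x H.∙ φ y)) →
         (∀ {x y} → φ x H.≈ φ y → x G.≈ y) →
         (∀ y → ∃ λ x → φ x H.≈ y) →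
         G ≅ H
  mk-≅ φ cong-φ homo injective surjective = φ , record
    { isGroupMonomorphism = record
      { isGroupHomomorphism = record
        { isMonoidHomomorphism = record
          { isMagmaHomomorphism = record
            { isRelHomomorphism = record { cong = cong-φ }
            ; homo = homo
            }
          ; ε-homo = ε-homo
          }
        ; ⁻¹-homo = λ x → GroupProperties.inverseˡ-unique H (φ (x G.⁻¹)) (φ x)
            (H.trans (H.sym (homo (x G.⁻¹) x)) (H.trans (cong-φ (G.inverseˡ x)) ε-homo))
        }
      ; injective = injective
      }
    ; surjective = λ y → let x , φx≈y = surjective y in
        x , λ z≈x → H.trans (cong-φ z≈x) φx≈y
    }
    where
    ε-homo : φ G.ε H.≈ H.ε
    ε-homo = GroupProperties.identityʳ-unique H (φ G.ε) (φ G.ε)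
      (H.trans (H.sym (homo G.ε G.ε)) (cong-φ (G.identityˡ G.ε)))

-- The inverse map takes the preimages supplied by surjectivity; equations between its values are
-- checked after applying `φ`, which is injective.
≅-sym : ∀ {G H} → G ≅ H → H ≅ G
≅-sym {G} {H} (φ , iso) = mk-≅ {H} {G} ψ
  (λ {x} {y} x≈y → injective (H.trans (φψ x) (H.trans x≈y (H.sym (φψ y)))))
  (λ x y → injective (H.trans (φψ (x H.∙ y))
    (H.sym (H.trans (∙-homo (ψ x) (ψ y)) (H.∙-cong (φψ x) (φψ y))))))
  (λ {x} {y} e → H.trans (H.sym (φψ x)) (H.trans (⟦⟧-cong e) (φψ y)))
  (λ x → φ x , injective (φψ (φ x)))
  where
  module G = Group G
  module H = Group H
  open IsGroupIsomorphism iso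
  ψ : H.Carrier → G.Carrier
  ψ y = proj₁ (surjective y)
  φψ : ∀ y → φ (ψ y) H.≈ y
  φψ y = proj₂ (surjective y) G.refl

≅-trans : ∀ {G H K} → G ≅ H → H ≅ K → G ≅ K
≅-trans {K = K} (φ , φ-iso) (ψ , ψ-iso) =
  ψ ∘ φ , Composition.isGroupIsomorphism (Group.trans K) φ-iso ψ-iso

-- Conjugation by `τ`.
Sym-cong : ∀ {A B : Set} → A ↔ B → Sym A ≅ Sym B
Sym-cong {A} {B} τ = mk-≅ {Sym A} {Sym B}
  (λ f → τ ↔-∘ (f ↔-∘ ↔-sym τ))
  (λ f≈g y → cong (to τ) (f≈g (from τ y)))
  (λ f g y → cong (to τ ∘ to f) (sym (τ⁻¹τ (to g (from τ y)))))
  (λ {f} {g} e x → begin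
    to f x                                    ≡⟨ τ⁻¹τ (to f x) ⟨
    from τ (to τ (to f x))                    ≡⟨ cong (from τ ∘ to τ ∘ to f) (τ⁻¹τ x) ⟨
    from τ (to τ (to f (from τ (to τ x))))    ≡⟨ cong (from τ) (e (to τ x)) ⟩
    from τ (to τ (to g (from τ (to τ x))))    ≡⟨ cong (from τ ∘ to τ ∘ to g) (τ⁻¹τ x) ⟩
    from τ (to τ (to g x))                    ≡⟨ τ⁻¹τ (to g x) ⟩
    to g x                                    ∎)
  (λ g → ↔-sym τ ↔-∘ (g ↔-∘ τ) , λ y →
    trans (ττ⁻¹ (to g (to τ (from τ y)))) (cong (to g) (ττ⁻¹ y)))
  where
  open ≡-Reasoning
  τ⁻¹τ = Inverse.strictlyInverseʳ τ
  ττ⁻¹ = Inverse.strictlyInverseˡ τ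

power-generated : ∀ G g n → Generated G g (power G g n)
power-generated G g zero    = unit
power-generated G g (suc n) = product generator (power-generated G g n)

-- It suffices that the powers g⁰, g¹, g² are closed under products, as the
-- inverse of gᵐ is then the power of g by the inverse of m in C₃.
generated⇒power : ∀ G g →
  let open Group G in
  (∀ m n → power G g (toℕ (AbelianGroup._∙_ C₃ m n)) ≈ power G g (toℕ m) ∙ power G g (toℕ n)) →
  ∀ {x} → Generated G g x → ∃ λ (m : Fin 3) → power G g (toℕ m) ≈ x
generated⇒power G g homo = go
  where
  module G = Group G
  module C₃ = AbelianGroup C₃
  go : ∀ {x} → Generated G g x → ∃ λ (m : Fin 3) → power G g (toℕ m) G.≈ x
  go generator        = 1F , G.identityʳ g
  go unit             = 0F , G.refl
  go (product p p′)   = let m , e = go p ; n , e′ = go p′ in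
    m C₃.∙ n , G.trans (homo m n) (G.∙-cong e e′)
  go (inverse p)      = let m , e = go p in
    m C₃.⁻¹ , G.trans
      (GroupProperties.inverseˡ-unique G (power G g (toℕ (m C₃.⁻¹))) (power G g (toℕ m))
        (G.trans (G.sym (homo (m C₃.⁻¹) m))
          (G.reflexive (cong (power G g ∘ toℕ) (C₃.inverseˡ m)))))
      (G.⁻¹-cong e)
  go (respects x≈y p) = let m , e = go p in m , G.trans e x≈y

-- Finite types

-- Finiteness is given by decision procedures for the quantifiers, so that statements about all
-- elements can be settled by evaluation.
record Finite (A : Set) : Set₁ where
  field
    _≟_     : DecidableEquality A
    forall? : ∀ {P : A → Set} → (∀ x → Dec (P x)) → Dec (∀ x → P x)
    exists? : ∀ {P : A → Set} → (∀ x → Dec (P x)) → Dec (∃ P)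

open Finite

Fin-finite : ∀ n → Finite (Fin n)
Fin-finite n = record { _≟_ = Fin._≟_ ; forall? = Fin.all? ; exists? = Fin.any? }

×-finite : ∀ {A B} → Finite A → Finite B → Finite (A × B)
×-finite A B = record
  { _≟_     = Product.≡-dec (_≟_ A) (_≟_ B)
  ; forall? = λ P? → map′ uncurry (λ p x y → p (x , y))
      (forall? A λ x → forall? B λ y → P? (x , y))
  ; exists? = λ P? → map′ (λ (x , y , p) → (x , y) , p) (λ ((x , y) , p) → x , y , p)
      (exists? A λ x → exists? B λ y → P? (x , y))
  }

retract-≟ : {A B : Set} (f : A → B) (g : B → A) → (∀ x → g (f x) ≡ x) →
            DecidableEquality B → DecidableEquality A
retract-≟ f g gf _≟ᴮ_ x y =
  map′ (λ e → trans (sym (gf x)) (trans (cong g e) (gf y))) (cong f) (f x ≟ᴮ f y)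

retract-finite : {A B : Set} (f : A → B) (g : B → A) → (∀ x → g (f x) ≡ x) →
                 Finite B → Finite A
retract-finite f g gf B = record
  { _≟_     = retract-≟ f g gf (_≟_ B)
  ; forall? = λ {P} P? → map′ (λ p x → subst P (gf x) (p (f x))) (λ p y → p (g y))
      (forall? B λ y → P? (g y))
  ; exists? = λ {P} P? → map′ (λ (y , p) → g y , p) (λ (x , p) → f x , subst P (sym (gf x)) p)
      (exists? B λ y → P? (g y))
  }

each𝒯 : ∀ {P : 𝒯 → Set} → P a → P b → P c → ∀ x → P x
each𝒯 pa pb pc a = pa
each𝒯 pa pb pc b = pb
each𝒯 pa pb pc c = pc

eachI : ∀ {P : I → Set} → P 𝟏 → P 𝟐 → P 𝟑 → ∀ i → P i
eachI p₁ p₂ p₃ 𝟏 = p₁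
eachI p₁ p₂ p₃ 𝟐 = p₂
eachI p₁ p₂ p₃ 𝟑 = p₃

𝒯-finite : Finite 𝒯
𝒯-finite = retract-finite index label (each𝒯 refl refl refl) (Fin-finite 3)
  where
  index : 𝒯 → Fin 3
  index = each𝒯 0F 1F 2F
  label : Fin 3 → 𝒯
  label 0F = a
  label 1F = b
  label 2F = c

I-finite : Finite I
I-finite = retract-finite index label (eachI refl refl refl) (Fin-finite 3)
  where
  index : I → Fin 3
  index = eachI 0F 1F 2F
  label : Fin 3 → I
  label 0F = 𝟏
  label 1F = 𝟐
  label 2F = 𝟑

_≟ₚ_ : DecidableEquality TPPoint
_≟ₚ_ = retract-≟ encode decode
  (λ { (q^ x) → refl ; (x at i) → refl ; q₁₂ → refl ; q₁₃ → refl ; q₂₃ → refl })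
  (Sum.≡-dec (_≟_ 𝒯-finite) (Sum.≡-dec (_≟_ (×-finite 𝒯-finite I-finite)) Fin._≟_))
  where
  encode : TPPoint → 𝒯 ⊎ (𝒯 × I) ⊎ Fin 3
  encode (q^ x)   = inj₁ x
  encode (x at i) = inj₂ (inj₁ (x , i))
  encode q₁₂      = inj₂ (inj₂ 0F)
  encode q₁₃      = inj₂ (inj₂ 1F)
  encode q₂₃      = inj₂ (inj₂ 2F)
  decode : 𝒯 ⊎ (𝒯 × I) ⊎ Fin 3 → TPPoint
  decode (inj₁ x)              = q^ x
  decode (inj₂ (inj₁ (x , i))) = x at i
  decode (inj₂ (inj₂ 0F))      = q₁₂
  decode (inj₂ (inj₂ 1F))      = q₁₃
  decode (inj₂ (inj₂ 2F))      = q₂₃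

open DecMembership _≟ₚ_ using (_∈?_)

-- Proof by evaluation: on closed data `does P?` reduces to `true`, and `refl` proves the equation.
witness : ∀ {P : Set} (P? : Dec P) → does P? ≡ true → P
witness (yes p) _ = p

-- Automorphisms

↔-injective : ∀ {A B : Set} (f : A ↔ B) {x y} → to f x ≡ to f y → x ≡ y
↔-injective f {x} {y} e = trans (sym (Inverse.strictlyInverseʳ f x))
  (trans (cong (from f) e) (Inverse.strictlyInverseʳ f y))

automorphism-cong : ∀ 𝔑 {f g} →
  (∀ p → to f p ≡ to g p) → IsAutomorphism 𝔑 f → IsAutomorphism 𝔑 g
automorphism-cong 𝔑 {f} {g} f≈g F = record
  { into = λ l → let l′ , e = into l in l′ , image-≐ e
  ; onto = λ l′ → let l , e = onto l′ in l , image-≐ e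
  }
  where
  open IsAutomorphism F
  image-≐ : ∀ {S T} → image f S ≐ T → image g S ≐ T
  image-≐ (p , p′) =
      (λ (x , x∈S , e) → p (x , x∈S , trans (f≈g x) e))
    , (λ y∈T → let x , x∈S , e = p′ y∈T in x , x∈S , trans (sym (f≈g x)) e)

open Perspectives

ξ-flip : ∀ Ξ i j π → ξ Ξ i j ≈𝒯 π → ξ Ξ j i ≈𝒯 (π ⁻¹𝒯)
ξ-flip Ξ i j π e x =
  trans (ξ-inverse Ξ i j x) (Group.⁻¹-cong S𝒯 {ξ Ξ i j} {π} e x)

_≈ₚ_ : Perspectives → Perspectives → Set
Ξ ≈ₚ Ξ′ = ∀ i j → ξ Ξ i j ≈𝒯 ξ Ξ′ i j

-- A case fixes `ξ` only up to pointwise equality; this allows passing to one concrete system, in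
-- which the search can be evaluated.
TP-cong : ∀ {Ξ Ξ′} → Ξ ≈ₚ Ξ′ → ∀ {f} → IsAutomorphism (TP Ξ) f → IsAutomorphism (TP Ξ′) f
TP-cong {Ξ} {Ξ′} Ξ≈Ξ′ {f} F = record
  { into = λ l → let l′ , e = into l in l′ , image-≐ l l′ e
  ; onto = λ l′ → let l , e = onto l′ in l , image-≐ l l′ e
  }
  where
  open IsAutomorphism F
  open IncidenceStructure (TP Ξ) using (⟦_⟧)
  open IncidenceStructure (TP Ξ′) using () renaming (⟦_⟧ to ⟦_⟧′)
  ⟦⟧-cong : ∀ l {p} → (⟦ l ⟧ p → ⟦ l ⟧′ p) × (⟦ l ⟧′ p → ⟦ l ⟧ p)
  ⟦⟧-cong L          = id , id
  ⟦⟧-cong Q          = id , id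
  ⟦⟧-cong (A-line i) = id , id
  ⟦⟧-cong (B-line i) = id , id
  ⟦⟧-cong (C-line i) = id , id
  ⟦⟧-cong (perspective i j i≢j x) {p} =
      subst (λ y → ⁅ q i j i≢j , x at i , y at j ⁆ p) (Ξ≈Ξ′ i j x)
    , subst (λ y → ⁅ q i j i≢j , x at i , y at j ⁆ p) (sym (Ξ≈Ξ′ i j x))
  image-≐ : ∀ l l′ → image f ⟦ l ⟧ ≐ ⟦ l′ ⟧ → image f ⟦ l ⟧′ ≐ ⟦ l′ ⟧′
  image-≐ l l′ (p , p′) =
      (λ (x , x∈l , e) → proj₁ (⟦⟧-cong l′) (p (x , proj₂ (⟦⟧-cong l) x∈l , e)))
    , (λ y∈l′ → let x , x∈l , e = p′ (proj₂ (⟦⟧-cong l′) y∈l′) in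
        x , proj₁ (⟦⟧-cong l) x∈l , e)

-- Maps `β × α` compatible with the perspectives

Commutes : Perspectives → Perm𝒯 → PermI → Set
Commutes Ξ β α = ∀ i j x → to (ξ Ξ (to α i) (to α j)) (to β x) ≡ to β (to (ξ Ξ i j) x)

commutes-⁻¹ : ∀ Ξ β α → Commutes Ξ β α → Commutes Ξ (↔-sym β) (↔-sym α)
commutes-⁻¹ Ξ β α comm i j x = ↔-injective β (begin
  to β (to (ξ Ξ i′ j′) x′)                        ≡⟨ comm i′ j′ x′ ⟨
  to (ξ Ξ (to α i′) (to α j′)) (to β x′)          ≡⟨ cong₂ (λ k l → to (ξ Ξ k l) (to β x′)) (αα⁻¹ i) (αα⁻¹ j) ⟩
  to (ξ Ξ i j) (to β x′)                          ≡⟨ cong (to (ξ Ξ i j)) (ββ⁻¹ x) ⟩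
  to (ξ Ξ i j) x                                  ≡⟨ ββ⁻¹ (to (ξ Ξ i j) x) ⟨
  to β (from β (to (ξ Ξ i j) x))                  ∎)
  where
  open ≡-Reasoning
  αα⁻¹ = Inverse.strictlyInverseˡ α
  ββ⁻¹ = Inverse.strictlyInverseˡ β
  i′ = from α i
  j′ = from α j
  x′ = from β x

-- The side of the triangle `i` opposite its vertex `x`. Indexing the three families of lines by `𝒯`
-- lets `β` act on them.
side : 𝒯 → I → TPLine
side a = A-line
side b = B-line
side c = C-line

line-map : Perm𝒯 → PermI → TPLine → TPLine
line-map β α L                       = L
line-map β α Q                       = Q
line-map β α (A-line i)              = side (to β a) (to α i)
line-map β α (B-line i)              = side (to β b) (to α i)
line-map β α (C-line i)              = side (to β c) (to α i)
line-map β α (perspective i j i≢j x) =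
  perspective (to α i) (to α j) (λ e → i≢j (↔-injective α e)) (to β x)

line-map-inverse : ∀ β α β′ α′ → (∀ x → to β (to β′ x) ≡ x) → (∀ i → to α (to α′ i) ≡ i) →
                   ∀ l → line-map β α (line-map β′ α′ l) ≡ l
line-map-inverse β α β′ α′ ββ′ αα′ = inverse-at
  where
  side-map : ∀ x i → line-map β α (side x i) ≡ side (to β x) (to α i)
  side-map = each𝒯 (λ _ → refl) (λ _ → refl) (λ _ → refl)
  on-side : ∀ x i → line-map β α (side (to β′ x) (to α′ i)) ≡ side x i
  on-side x i = trans (side-map (to β′ x) (to α′ i)) (cong₂ side (ββ′ x) (αα′ i))
  perspective-cong : ∀ {i i′ j j′ x x′} → i ≡ i′ → j ≡ j′ → x ≡ x′ →
    .(e : i ≢ j) .(e′ : i′ ≢ j′) → perspective i j e x ≡ perspective i′ j′ e′ x′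
  perspective-cong refl refl refl _ _ = refl
  inverse-at : ∀ l → line-map β α (line-map β′ α′ l) ≡ l
  inverse-at L                       = refl
  inverse-at Q                       = refl
  inverse-at (A-line i)              = on-side a i
  inverse-at (B-line i)              = on-side b i
  inverse-at (C-line i)              = on-side c i
  inverse-at (perspective i j i≢j x) = perspective-cong (αα′ i) (αα′ j) (ββ′ x) _ i≢j

module _ (Ξ : Perspectives) where
  open IncidenceStructure (TP Ξ) using (⟦_⟧)

  -- The sides, `L` and `Q` are preserved by every `β × α`; commutation enters at the third point of
  -- a perspective line.
  act-∈ : ∀ β α → Commutes Ξ β α → ∀ l {p} → ⟦ l ⟧ p → ⟦ line-map β α l ⟧ (act β α p)
  act-∈ β α comm = on-line
    where
    q^-∈-L : ∀ x → ⟦ L ⟧ (q^ x)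
    q^-∈-L = each𝒯 (inj₁ refl) (inj₂ (inj₁ refl)) (inj₂ (inj₂ refl))
    q-∈-Q : ∀ i j .(i≢j : i ≢ j) → ⟦ Q ⟧ (q i j i≢j)
    q-∈-Q 𝟏 𝟏 i≢j = ⊥-elim-irr (i≢j refl)
    q-∈-Q 𝟏 𝟐 _   = inj₁ refl
    q-∈-Q 𝟏 𝟑 _   = inj₂ (inj₁ refl)
    q-∈-Q 𝟐 𝟏 _   = inj₁ refl
    q-∈-Q 𝟐 𝟐 i≢j = ⊥-elim-irr (i≢j refl)
    q-∈-Q 𝟐 𝟑 _   = inj₂ (inj₂ refl)
    q-∈-Q 𝟑 𝟏 _   = inj₂ (inj₁ refl)
    q-∈-Q 𝟑 𝟐 _   = inj₂ (inj₂ refl)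
    q-∈-Q 𝟑 𝟑 i≢j = ⊥-elim-irr (i≢j refl)
    q^-∈-side : ∀ x {i} → ⟦ side x i ⟧ (q^ x)
    q^-∈-side = each𝒯 (inj₁ refl) (inj₁ refl) (inj₁ refl)
    at-∈-side : ∀ x y {i} → x ≢ y → ⟦ side x i ⟧ (y at i)
    at-∈-side a a x≢y = contradiction refl x≢y
    at-∈-side a b _   = inj₂ (inj₁ refl)
    at-∈-side a c _   = inj₂ (inj₂ refl)
    at-∈-side b a _   = inj₂ (inj₁ refl)
    at-∈-side b b x≢y = contradiction refl x≢y
    at-∈-side b c _   = inj₂ (inj₂ refl)
    at-∈-side c a _   = inj₂ (inj₁ refl)
    at-∈-side c b _   = inj₂ (inj₂ refl)
    at-∈-side c c x≢y = contradiction refl x≢y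
    image-at-∈-side : ∀ x y {i} → x ≢ y → ⟦ side (to β x) (to α i) ⟧ (to β y at to α i)
    image-at-∈-side x y x≢y = at-∈-side (to β x) (to β y) (x≢y ∘ ↔-injective β)
    on-line : ∀ l {p} → ⟦ l ⟧ p → ⟦ line-map β α l ⟧ (act β α p)
    on-line L (inj₁ refl)                 = q^-∈-L (to β a)
    on-line L (inj₂ (inj₁ refl))          = q^-∈-L (to β b)
    on-line L (inj₂ (inj₂ refl))          = q^-∈-L (to β c)
    on-line Q (inj₁ refl)                 = q-∈-Q (to α 𝟏) (to α 𝟐) _
    on-line Q (inj₂ (inj₁ refl))          = q-∈-Q (to α 𝟏) (to α 𝟑) _
    on-line Q (inj₂ (inj₂ refl))          = q-∈-Q (to α 𝟐) (to α 𝟑) _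
    on-line (A-line i) (inj₁ refl)        = q^-∈-side (to β a)
    on-line (A-line i) (inj₂ (inj₁ refl)) = image-at-∈-side a b λ ()
    on-line (A-line i) (inj₂ (inj₂ refl)) = image-at-∈-side a c λ ()
    on-line (B-line i) (inj₁ refl)        = q^-∈-side (to β b)
    on-line (B-line i) (inj₂ (inj₁ refl)) = image-at-∈-side b a λ ()
    on-line (B-line i) (inj₂ (inj₂ refl)) = image-at-∈-side b c λ ()
    on-line (C-line i) (inj₁ refl)        = q^-∈-side (to β c)
    on-line (C-line i) (inj₂ (inj₁ refl)) = image-at-∈-side c a λ ()
    on-line (C-line i) (inj₂ (inj₂ refl)) = image-at-∈-side c b λ ()
    -- The line name carries an irrelevant proof of `i ≢ j`, while `act-q` takes a relevant one; a
    -- negation can be recomputed.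
    on-line (perspective i j i≢j x) (inj₁ refl) =
      inj₁ (sym (act-q β α i j (¬-recompute i≢j)))
    on-line (perspective i j i≢j x) (inj₂ (inj₁ refl)) = inj₂ (inj₁ refl)
    on-line (perspective i j i≢j x) (inj₂ (inj₂ refl)) =
      inj₂ (inj₂ (cong (_at to α j) (comm i j x)))

  -- `act-∈` gives one inclusion between the image of a line and a line; applied to the inverse map,
  -- which commutes too, it gives the other.
  commutes⇒automorphism : ∀ β α → Commutes Ξ β α → IsAutomorphism (TP Ξ) (β ⊠ α)
  commutes⇒automorphism β α comm = record
    { into = λ l  → line-map β α l , image-≐ l (line-map β α l) refl (line-map⁻¹ l)
    ; onto = λ l′ → line-map β⁻¹ α⁻¹ l′ , image-≐ (line-map β⁻¹ α⁻¹ l′) l′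
        (line-map-inverse β α β⁻¹ α⁻¹
          (Inverse.strictlyInverseˡ β) (Inverse.strictlyInverseˡ α) l′)
        refl
    }
    where
    β⁻¹ = ↔-sym β
    α⁻¹ = ↔-sym α
    line-map⁻¹ : ∀ l → line-map β⁻¹ α⁻¹ (line-map β α l) ≡ l
    line-map⁻¹ = line-map-inverse β⁻¹ α⁻¹ β α
      (Inverse.strictlyInverseʳ β) (Inverse.strictlyInverseʳ α)
    image-≐ : ∀ l l′ → line-map β α l ≡ l′ → line-map β⁻¹ α⁻¹ l′ ≡ l →
              image (β ⊠ α) ⟦ l ⟧ ≐ ⟦ l′ ⟧
    image-≐ l l′ e e′ =
        (λ { (p , p∈l , refl) → subst (λ m → ⟦ m ⟧ (act β α p)) e (act-∈ β α comm l p∈l) })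
      , λ {p} p∈l′ →
          act β⁻¹ α⁻¹ p
        , subst (λ m → ⟦ m ⟧ (act β⁻¹ α⁻¹ p)) e′
            (act-∈ β⁻¹ α⁻¹ (commutes-⁻¹ Ξ β α comm) l′ p∈l′)
        , Inverse.strictlyInverseˡ (β ⊠ α) p

-- The search

-- A nondeterministic search kept as a syntax tree, so that its results are described by the
-- proposition `_∈ˢ_` and checked without first being collected in a list.
data Search (A : Set) : Set₁ where
  choose : List A → Search A
  _>>=_  : ∀ {B} → Search B → (B → Search A) → Search A
  when   : ∀ {P} → Dec P → Search A → Search A

_∈ˢ_ : ∀ {A} → A → Search A → Set
y ∈ˢ choose xs    = y ∈ xs
y ∈ˢ (e >>= f)    = ∃ λ x → x ∈ˢ e × y ∈ˢ f x
y ∈ˢ when {P} _ e = P × y ∈ˢ e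

-- A choice becomes a universal quantifier and a test the premise of an implication, so that a
-- failed test cuts off its branch.
every? : ∀ {A} {Q : A → Set} → (∀ y → Dec (Q y)) → (e : Search A) → Dec (∀ y → y ∈ˢ e → Q y)
every? Q? (choose xs) =
  map′ (λ all _ → All.lookup all) (λ h → All.tabulate (h _)) (All.all? Q? xs)
every? Q? (e >>= f)   =
  map′ (λ h y (x , x∈e , y∈fx) → h x x∈e y y∈fx) (λ h x x∈e y y∈fx → h y (x , x∈e , y∈fx))
    (every? (λ x → every? Q? (f x)) e)
every? Q? (when P? e) =
  map′ (λ h y (p , y∈e) → h p y y∈e) (λ h p y y∈e → h y (p , y∈e)) (P? →-dec every? Q? e)

points : List TPPoint
points = q^ a ∷ q^ b ∷ q^ c
       ∷ a at 𝟏 ∷ b at 𝟏 ∷ c at 𝟏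
       ∷ a at 𝟐 ∷ b at 𝟐 ∷ c at 𝟐
       ∷ a at 𝟑 ∷ b at 𝟑 ∷ c at 𝟑
       ∷ q₁₂ ∷ q₁₃ ∷ q₂₃ ∷ []

∈-points : ∀ p → p ∈ points
∈-points p = witness (p ∈? points) (computed p)
  where
  computed : ∀ p → does (p ∈? points) ≡ true
  computed (q^ a)   = refl
  computed (q^ b)   = refl
  computed (q^ c)   = refl
  computed (a at 𝟏) = refl
  computed (a at 𝟐) = refl
  computed (a at 𝟑) = refl
  computed (b at 𝟏) = refl
  computed (b at 𝟐) = refl
  computed (b at 𝟑) = refl
  computed (c at 𝟏) = refl
  computed (c at 𝟐) = refl
  computed (c at 𝟑) = refl
  computed q₁₂      = refl
  computed q₁₃      = refl
  computed q₂₃      = refl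

-- The value table of a map; equality of tables is decidable and amounts to pointwise equality of
-- maps.
frame : (TPPoint → TPPoint) → List TPPoint
frame f = map f points

frame-injective : ∀ {f g} → frame f ≡ frame g → ∀ p → f p ≡ g p
frame-injective {f} {g} e p = map-≡ points e (∈-points p)
  where
  map-≡ : ∀ ps → map f ps ≡ map g ps → ∀ {p} → p ∈ ps → f p ≡ g p
  map-≡ (_ ∷ ps) e (here refl) = List.∷-injectiveˡ e
  map-≡ (_ ∷ ps) e (there p∈)  = map-≡ ps (List.∷-injectiveʳ e) p∈

frame-cong : ∀ {f g} → (∀ p → f p ≡ g p) → frame f ≡ frame g
frame-cong f≗g = List.map-cong f≗g points

-- Third points on lines

record Triangle : Set where
  constructor ⟨_,_,_⟩
  field vertex-a vertex-b vertex-c : TPPoint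

_!_ : Triangle → 𝒯 → TPPoint
⟨ p , _ , _ ⟩ ! a = p
⟨ _ , p , _ ⟩ ! b = p
⟨ _ , _ , p ⟩ ! c = p

others : 𝒯 → 𝒯 → List 𝒯
others a b = [ c ]
others a c = [ b ]
others b a = [ c ]
others b c = [ a ]
others c a = [ b ]
others c b = [ a ]
others _ _ = []

provided : ∀ {P A : Set} → Dec P → A → List A
provided (yes _) x = [ x ]
provided (no _)  x = []

∈-provided : ∀ {P A : Set} (P? : Dec P) {x : A} → P → x ∈ provided P? x
∈-provided (yes _) _ = here refl
∈-provided (no ¬p) p = contradiction p ¬p

module Frames (Ξ : Perspectives) where

  open IncidenceStructure (TP Ξ) using (⟦_⟧)

  private
    infix 30 _⟶_
    _⟶_ : I → I → 𝒯 → 𝒯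
    i ⟶ j = to (ξ Ξ i j)

  meet : 𝒯 → 𝒯 → TPPoint → List TPPoint
  meet x y = provided (_≟_ 𝒯-finite x y)

  -- Two vertices of one triangle span a side, which meets the axis; vertices of different triangles
  -- are joined only if `ξ` matches them, and then by a line through the centre.
  between : I → I → 𝒯 → 𝒯 → List TPPoint
  between 𝟏 𝟏 x y = map q^ (others x y)
  between 𝟐 𝟐 x y = map q^ (others x y)
  between 𝟑 𝟑 x y = map q^ (others x y)
  between 𝟏 𝟐 x y = meet ((𝟏 ⟶ 𝟐) x) y q₁₂
  between 𝟏 𝟑 x y = meet ((𝟏 ⟶ 𝟑) x) y q₁₃
  between 𝟐 𝟏 x y = meet ((𝟐 ⟶ 𝟏) x) y q₁₂
  between 𝟐 𝟑 x y = meet ((𝟐 ⟶ 𝟑) x) y q₂₃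
  between 𝟑 𝟏 x y = meet ((𝟑 ⟶ 𝟏) x) y q₁₃
  between 𝟑 𝟐 x y = meet ((𝟑 ⟶ 𝟐) x) y q₂₃

  -- A centre is joined only to vertices of the two triangles that it relates; otherwise the list is
  -- empty.
  opposite : TPPoint → 𝒯 → I → List TPPoint
  opposite q₁₂ x 𝟏 = [ (𝟏 ⟶ 𝟐) x at 𝟐 ]
  opposite q₁₂ x 𝟐 = [ (𝟐 ⟶ 𝟏) x at 𝟏 ]
  opposite q₁₃ x 𝟏 = [ (𝟏 ⟶ 𝟑) x at 𝟑 ]
  opposite q₁₃ x 𝟑 = [ (𝟑 ⟶ 𝟏) x at 𝟏 ]
  opposite q₂₃ x 𝟐 = [ (𝟐 ⟶ 𝟑) x at 𝟑 ]
  opposite q₂₃ x 𝟑 = [ (𝟑 ⟶ 𝟐) x at 𝟐 ]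
  opposite _   _ _ = []

  -- The points r such that {p, q, r} is a line with three distinct points;
  -- there is at most one.
  thirds : TPPoint → TPPoint → List TPPoint
  thirds (q^ x)   (q^ y)   = map q^ (others x y)
  thirds (q^ x)   (y at i) = map (_at i) (others x y)
  thirds (x at i) (q^ y)   = map (_at i) (others x y)
  thirds (x at i) (y at j) = between i j x y
  thirds (x at i) p        = opposite p x i
  thirds p        (x at i) = opposite p x i
  thirds q₁₂      q₁₃      = [ q₂₃ ]
  thirds q₁₂      q₂₃      = [ q₁₃ ]
  thirds q₁₃      q₁₂      = [ q₂₃ ]
  thirds q₁₃      q₂₃      = [ q₁₂ ]
  thirds q₂₃      q₁₂      = [ q₁₃ ]
  thirds q₂₃      q₁₃      = [ q₁₂ ]
  thirds _        _        = []

  -- All six orders are listed because `thirds` is defined by cases and is not symmetric by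
  -- computation.
  record Collinear (p q r : TPPoint) : Set where
    constructor collinear
    field
      pq : r ∈ thirds p q
      qp : r ∈ thirds q p
      pr : q ∈ thirds p r
      rp : q ∈ thirds r p
      qr : p ∈ thirds q r
      rq : p ∈ thirds r q

  collinear⇒third : ∀ {p₀ p₁ p₂} → Collinear p₀ p₁ p₂ →
    ∀ {p q r} → ⁅ p₀ , p₁ , p₂ ⁆ p → ⁅ p₀ , p₁ , p₂ ⁆ q → ⁅ p₀ , p₁ , p₂ ⁆ r →
    p ≢ q → p ≢ r → q ≢ r → r ∈ thirds p q
  collinear⇒third γ = order
    where
    open Collinear γ
    order : ∀ {p q r} → ⁅ _ , _ , _ ⁆ p → ⁅ _ , _ , _ ⁆ q → ⁅ _ , _ , _ ⁆ r →
            p ≢ q → p ≢ r → q ≢ r → r ∈ thirds p q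
    order (inj₁ refl)        (inj₂ (inj₁ refl)) (inj₂ (inj₂ refl)) _ _ _ = pq
    order (inj₂ (inj₁ refl)) (inj₁ refl)        (inj₂ (inj₂ refl)) _ _ _ = qp
    order (inj₁ refl)        (inj₂ (inj₂ refl)) (inj₂ (inj₁ refl)) _ _ _ = pr
    order (inj₂ (inj₂ refl)) (inj₁ refl)        (inj₂ (inj₁ refl)) _ _ _ = rp
    order (inj₂ (inj₁ refl)) (inj₂ (inj₂ refl)) (inj₁ refl)        _ _ _ = qr
    order (inj₂ (inj₂ refl)) (inj₂ (inj₁ refl)) (inj₁ refl)        _ _ _ = rq
    order (inj₁ refl)        (inj₁ refl)        _ p≢q _ _ = contradiction refl p≢q
    order (inj₂ (inj₁ refl)) (inj₂ (inj₁ refl)) _ p≢q _ _ = contradiction refl p≢q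
    order (inj₂ (inj₂ refl)) (inj₂ (inj₂ refl)) _ p≢q _ _ = contradiction refl p≢q
    order (inj₁ refl)        _ (inj₁ refl)        _ p≢r _ = contradiction refl p≢r
    order (inj₂ (inj₁ refl)) _ (inj₂ (inj₁ refl)) _ p≢r _ = contradiction refl p≢r
    order (inj₂ (inj₂ refl)) _ (inj₂ (inj₂ refl)) _ p≢r _ = contradiction refl p≢r
    order _ (inj₁ refl)        (inj₁ refl)        _ _ q≢r = contradiction refl q≢r
    order _ (inj₂ (inj₁ refl)) (inj₂ (inj₁ refl)) _ _ q≢r = contradiction refl q≢r
    order _ (inj₂ (inj₂ refl)) (inj₂ (inj₂ refl)) _ _ q≢r = contradiction refl q≢r

  private
    pattern ∈! = here refl
    pattern evident = collinear ∈! ∈! ∈! ∈! ∈! ∈!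

  -- From `x at i` the definition of `ξ i j` suffices; from the vertex at `j`, `ξ j i` leads back,
  -- being the inverse of `ξ i j`.
  perspective-collinear : ∀ i j .(i≢j : i ≢ j) x →
    Collinear (q i j i≢j) (x at i) ((i ⟶ j) x at j)
  perspective-collinear i j i≢j x = go i j i≢j
    where
    back : ∀ i j → (j ⟶ i) ((i ⟶ j) x) ≡ x
    back i j = trans (ξ-inverse Ξ i j ((i ⟶ j) x)) (Inverse.strictlyInverseʳ (ξ Ξ i j) x)
    meet-∈ : ∀ y z {p} → y ≡ z → p ∈ meet y z p
    meet-∈ y z = ∈-provided (_≟_ 𝒯-finite y z)
    forth-meet-∈ : ∀ i j {p} → p ∈ meet ((i ⟶ j) x) ((i ⟶ j) x) p
    forth-meet-∈ i j = meet-∈ _ _ refl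
    back-meet-∈ : ∀ i j {p} → p ∈ meet ((j ⟶ i) ((i ⟶ j) x)) x p
    back-meet-∈ i j = meet-∈ _ _ (back i j)
    back-∈ : ∀ i j → x at i ∈ [ (j ⟶ i) ((i ⟶ j) x) at i ]
    back-∈ i j = here (cong (_at i) (sym (back i j)))
    go : ∀ i j .(i≢j : i ≢ j) → Collinear (q i j i≢j) (x at i) ((i ⟶ j) x at j)
    go 𝟏 𝟏 i≢j = ⊥-elim-irr (i≢j refl)
    go 𝟐 𝟐 i≢j = ⊥-elim-irr (i≢j refl)
    go 𝟑 𝟑 i≢j = ⊥-elim-irr (i≢j refl)
    go 𝟏 𝟐 _ = collinear ∈! ∈! (back-∈ 𝟏 𝟐) (back-∈ 𝟏 𝟐) (forth-meet-∈ 𝟏 𝟐) (back-meet-∈ 𝟏 𝟐)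
    go 𝟏 𝟑 _ = collinear ∈! ∈! (back-∈ 𝟏 𝟑) (back-∈ 𝟏 𝟑) (forth-meet-∈ 𝟏 𝟑) (back-meet-∈ 𝟏 𝟑)
    go 𝟐 𝟏 _ = collinear ∈! ∈! (back-∈ 𝟐 𝟏) (back-∈ 𝟐 𝟏) (forth-meet-∈ 𝟐 𝟏) (back-meet-∈ 𝟐 𝟏)
    go 𝟐 𝟑 _ = collinear ∈! ∈! (back-∈ 𝟐 𝟑) (back-∈ 𝟐 𝟑) (forth-meet-∈ 𝟐 𝟑) (back-meet-∈ 𝟐 𝟑)
    go 𝟑 𝟏 _ = collinear ∈! ∈! (back-∈ 𝟑 𝟏) (back-∈ 𝟑 𝟏) (forth-meet-∈ 𝟑 𝟏) (back-meet-∈ 𝟑 𝟏)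
    go 𝟑 𝟐 _ = collinear ∈! ∈! (back-∈ 𝟑 𝟐) (back-∈ 𝟑 𝟐) (forth-meet-∈ 𝟑 𝟐) (back-meet-∈ 𝟑 𝟐)

  -- Completeness of `thirds`, which ensures that the search misses no image of a line.
  line⇒third : ∀ l {p q r} → ⟦ l ⟧ p → ⟦ l ⟧ q → ⟦ l ⟧ r →
               p ≢ q → p ≢ r → q ≢ r → r ∈ thirds p q
  line⇒third L          = collinear⇒third evident
  line⇒third Q          = collinear⇒third evident
  -- The index is split because `between` reduces only on concrete indices.
  line⇒third (A-line 𝟏) = collinear⇒third evident
  line⇒third (A-line 𝟐) = collinear⇒third evident
  line⇒third (A-line 𝟑) = collinear⇒third evident
  line⇒third (B-line 𝟏) = collinear⇒third evident
  line⇒third (B-line 𝟐) = collinear⇒third evident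
  line⇒third (B-line 𝟑) = collinear⇒third evident
  line⇒third (C-line 𝟏) = collinear⇒third evident
  line⇒third (C-line 𝟐) = collinear⇒third evident
  line⇒third (C-line 𝟑) = collinear⇒third evident
  line⇒third (perspective i j i≢j x) = collinear⇒third (perspective-collinear i j i≢j x)

  -- Candidates for the images of axis, triangles and centres

  axes : Search Triangle
  axes = do
    p ← choose points
    q ← choose points
    r ← choose (thirds p q)
    choose [ ⟨ p , q , r ⟩ ]

  -- The vertex p = s ! a is excluded, as it yields the degenerate triangle s.
  triangles : Triangle → Search Triangle
  triangles s = do
    p ← choose points
    -- The side through `s ! b` determines the vertex `r`, the side through `s ! c` the vertex `q`;
    -- the side through `s ! a` must then close the triangle.
    r ← choose (thirds (s ! b) p)
    q ← choose (thirds (s ! c) p)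
    when (¬? (p ≟ₚ (s ! a)) ×-dec (r ∈? thirds (s ! a) q))
      (choose [ ⟨ p , q , r ⟩ ])

  -- An image triangle inherits the labels of its vertices, so the original `ξ i j` matches the
  -- vertices of `t` and `u`; the three joining lines must share the point `p`.
  centres : I → I → Triangle → Triangle → Search TPPoint
  centres i j t u = do
    p ← choose (ray a)
    when ((p ∈? ray b) ×-dec (p ∈? ray c)) (choose [ p ])
    where
    ray : 𝒯 → List TPPoint
    ray x = thirds (t ! x) (u ! (i ⟶ j) x)

  frames : Search (List TPPoint)
  frames = do
    s ← axes
    t ← triangles s
    u ← triangles s
    -- Taken before `v`, so that pairs of triangles without a centre are discarded before a third
    -- triangle is tried.
    p ← centres 𝟏 𝟐 t u
    v ← triangles s
    q ← centres 𝟏 𝟑 t v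
    r ← centres 𝟐 𝟑 u v
    when (r ∈? thirds p q)
      -- The order is that of `points`, which makes the result comparable with a `frame`.
      (choose
        [ s ! a ∷ s ! b ∷ s ! c
        ∷ t ! a ∷ t ! b ∷ t ! c
        ∷ u ! a ∷ u ! b ∷ u ! c
        ∷ v ! a ∷ v ! b ∷ v ! c
        ∷ p ∷ q ∷ r ∷ [] ])

  -- Completeness of the search

  module _ (f : TPPoint ↔ TPPoint) (F : IsAutomorphism (TP Ξ) f) where

    private
      -- The image of a line lies on a line, and `f` keeps its points distinct, so `line⇒third`
      -- applies to the images.
      third-image : ∀ l {p q r} → ⟦ l ⟧ p → ⟦ l ⟧ q → ⟦ l ⟧ r →
                    p ≢ q → p ≢ r → q ≢ r → to f r ∈ thirds (to f p) (to f q)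
      third-image l p∈l q∈l r∈l p≢q p≢r q≢r =
        line⇒third l′ (∈-image p∈l) (∈-image q∈l) (∈-image r∈l)
          (p≢q ∘ ↔-injective f) (p≢r ∘ ↔-injective f) (q≢r ∘ ↔-injective f)
        where
        l′ = proj₁ (IsAutomorphism.into F l)
        ∈-image : ∀ {p} → ⟦ l ⟧ p → ⟦ l′ ⟧ (to f p)
        ∈-image p∈l = proj₁ (proj₂ (IsAutomorphism.into F l)) (_ , p∈l , refl)

      pattern 1st = inj₁ refl
      pattern 2nd = inj₂ (inj₁ refl)
      pattern 3rd = inj₂ (inj₂ refl)

      axis : Triangle
      axis = ⟨ to f (q^ a) , to f (q^ b) , to f (q^ c) ⟩

      triangle : I → Triangle
      triangle i = ⟨ to f (a at i) , to f (b at i) , to f (c at i) ⟩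

      triangle-! : ∀ i x → triangle i ! x ≡ to f (x at i)
      triangle-! i = each𝒯 refl refl refl

      axis-∈ : axis ∈ˢ axes
      axis-∈ = _ , ∈-points _ , _ , ∈-points _ ,
        _ , third-image L 1st 2nd 3rd (λ ()) (λ ()) (λ ()) , ∈!

      triangle-∈ : ∀ i → triangle i ∈ˢ triangles axis
      triangle-∈ i = _ , ∈-points _ ,
        _ , third-image (B-line i) 1st 2nd 3rd (λ ()) (λ ()) (λ ()) ,
        _ , third-image (C-line i) 1st 2nd 3rd (λ ()) (λ ()) (λ ()) ,
        ( (λ e → contradiction (↔-injective f e) λ ())
        , third-image (A-line i) 1st 2nd 3rd (λ ()) (λ ()) (λ ())) ,
        ∈!

      centre-∈ : ∀ {p} i j →
        (∀ x → p ∈ thirds (to f (x at i)) (to f ((i ⟶ j) x at j))) →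
        p ∈ˢ centres i j (triangle i) (triangle j)
      centre-∈ {p} i j p∈thirds = _ , p∈ray a , (p∈ray b , p∈ray c) , ∈!
        where
        p∈ray : ∀ x → p ∈ thirds (triangle i ! x) (triangle j ! (i ⟶ j) x)
        p∈ray x = subst (p ∈_)
          (sym (cong₂ thirds (triangle-! i x) (triangle-! j ((i ⟶ j) x)))) (p∈thirds x)

    -- Each choice in `frames` is answered by the image of the corresponding point or triangle, and
    -- each incidence test holds because `f` maps a line into a line.
    frame-∈ : frame (to f) ∈ˢ frames
    frame-∈ =
      axis , axis-∈ , triangle 𝟏 , triangle-∈ 𝟏 , triangle 𝟐 , triangle-∈ 𝟐 ,
      to f q₁₂ , centre-∈ 𝟏 𝟐 (λ x →
        third-image (perspective 𝟏 𝟐 (λ ()) x) 2nd 3rd 1st (λ ()) (λ ()) (λ ())) ,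
      triangle 𝟑 , triangle-∈ 𝟑 ,
      to f q₁₃ , centre-∈ 𝟏 𝟑 (λ x →
        third-image (perspective 𝟏 𝟑 (λ ()) x) 2nd 3rd 1st (λ ()) (λ ()) (λ ())) ,
      to f q₂₃ , centre-∈ 𝟐 𝟑 (λ x →
        third-image (perspective 𝟐 𝟑 (λ ()) x) 2nd 3rd 1st (λ ()) (λ ()) (λ ())) ,
      third-image Q 1st 2nd 3rd (λ ()) (λ ()) (λ ()) , ∈!

-- Representations of finite groups by automorphisms

-- Compatibility of the action with products is left to `IsFullAutomorphismGroup`, where it is
-- decided by evaluation. `≈⇒≡` lets the decidable equality of `finite` serve as that of the group.
record Representation : Set₁ where
  field
    group  : Group 0ℓ 0ℓ
    finite : Finite (Group.Carrier group)
    ≈⇒≡    : ∀ {g h} → Group._≈_ group g h → g ≡ h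
    on-𝒯   : Group.Carrier group → Perm𝒯
    on-I   : Group.Carrier group → PermI

  open Group group public using (Carrier; _∙_)

  on-points : Carrier → TPPoint ↔ TPPoint
  on-points g = on-𝒯 g ⊠ on-I g

module _ (Ξ : Perspectives) (V : Representation) where
  open Representation V
  open Frames Ξ

  -- Four decidable conditions: `commutes` makes the maps automorphisms, `homo` and `faithful` embed
  -- the group, and `exhaustive` shows that no other automorphism exists, as every automorphism has
  -- its frame among `frames`.
  record IsFullAutomorphismGroup : Set where
    constructor full
    field
      commutes   : ∀ g → Commutes Ξ (on-𝒯 g) (on-I g)
      homo       : ∀ g h → frame (to (on-points (g ∙ h))) ≡
                           frame (to (on-points g) ∘ to (on-points h))
      faithful   : ∀ g h → frame (to (on-points g)) ≡ frame (to (on-points h)) → g ≡ h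
      exhaustive : ∀ m → m ∈ˢ frames → ∃ λ g → frame (to (on-points g)) ≡ m

  isFullAutomorphismGroup? : Dec IsFullAutomorphismGroup
  isFullAutomorphismGroup? = map′
    (λ (p , q , r , s) → full p q r s) (λ (full p q r s) → p , q , r , s)
    (      (forall? finite λ g → forall? I-finite λ i → forall? I-finite λ j →
              forall? 𝒯-finite λ x → _≟_ 𝒯-finite _ _)
     ×-dec (forall? finite λ g → forall? finite λ h → frame-≟ _ _)
     ×-dec (forall? finite λ g → forall? finite λ h → frame-≟ _ _ →-dec _≟_ finite g h)
     ×-dec every? (λ m → exists? finite λ g → frame-≟ _ m) frames)
    where
    frame-≟ = List.≡-dec _≟ₚ_

module FullAutomorphismGroup
  {Ξ₀ : Perspectives} {V : Representation} (isFull : IsFullAutomorphismGroup Ξ₀ V)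
  {Ξ : Perspectives} (Ξ≈Ξ₀ : Ξ ≈ₚ Ξ₀) where

  open Representation V
  open IsFullAutomorphismGroup isFull

  on-points-automorphism : ∀ g → IsAutomorphism (TP Ξ) (on-points g)
  on-points-automorphism g = TP-cong {Ξ₀} {Ξ} (λ i j x → sym (Ξ≈Ξ₀ i j x))
    (commutes⇒automorphism Ξ₀ (on-𝒯 g) (on-I g) (commutes g))

  automorphism⇒on-points : ∀ f → IsAutomorphism (TP Ξ) f →
                           ∃ λ g → ∀ p → to (on-points g) p ≡ to f p
  automorphism⇒on-points f F =
    let g , e = exhaustive _ (Frames.frame-∈ Ξ₀ f (TP-cong {Ξ} {Ξ₀} Ξ≈Ξ₀ F)) in
    g , frame-injective e

  -- Built from the group towards `Aut (TP Ξ)`, where the map is explicit, and then inverted;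
  -- surjectivity is the exhaustiveness of the search.
  Aut-≅ : Aut (TP Ξ) ≅ group
  Aut-≅ = ≅-sym {group} {Aut (TP Ξ)} (mk-≅ {group} {Aut (TP Ξ)}
    (λ g → on-points g , on-points-automorphism g)
    (λ g≈h p → cong (λ g → to (on-points g) p) (≈⇒≡ g≈h))
    (λ g h → frame-injective (homo g h))
    (λ {g} {h} e → Group.reflexive group (faithful g h (frame-cong e)))
    (λ (f , F) → automorphism⇒on-points f F))

-- The fourteen cases

perspectives : Perm𝒯 → Perm𝒯 → Perm𝒯 → Perspectives
perspectives π₁₂ π₂₃ π₁₃ = record
  { ξ          = ξ′
  ; ξ-diagonal = eachI (λ _ → refl) (λ _ → refl) (λ _ → refl)
  ; ξ-inverse  = λ
      { 𝟏 𝟏 _ → refl ; 𝟏 𝟐 _ → refl ; 𝟏 𝟑 _ → refl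
      ; 𝟐 𝟏 _ → refl ; 𝟐 𝟐 _ → refl ; 𝟐 𝟑 _ → refl
      ; 𝟑 𝟏 _ → refl ; 𝟑 𝟐 _ → refl ; 𝟑 𝟑 _ → refl
      }
  }
  where
  ξ′ : I → I → Perm𝒯
  ξ′ 𝟏 𝟐 = π₁₂
  ξ′ 𝟐 𝟏 = ↔-sym π₁₂
  ξ′ 𝟐 𝟑 = π₂₃
  ξ′ 𝟑 𝟐 = ↔-sym π₂₃
  ξ′ 𝟏 𝟑 = π₁₃
  ξ′ 𝟑 𝟏 = ↔-sym π₁₃
  ξ′ _ _ = id𝒯

≈-perspectives : ∀ Ξ {π₁₂ π₂₃ π₁₃} → ξ Ξ 𝟏 𝟐 ≈𝒯 π₁₂ → ξ Ξ 𝟐 𝟑 ≈𝒯 π₂₃ → ξ Ξ 𝟏 𝟑 ≈𝒯 π₁₃ →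
                 Ξ ≈ₚ perspectives π₁₂ π₂₃ π₁₃
≈-perspectives Ξ {π₁₂} {π₂₃} {π₁₃} e₁₂ e₂₃ e₁₃ = λ
  { 𝟏 𝟏 → ξ-diagonal Ξ 𝟏 ; 𝟐 𝟐 → ξ-diagonal Ξ 𝟐 ; 𝟑 𝟑 → ξ-diagonal Ξ 𝟑
  ; 𝟏 𝟐 → e₁₂ ; 𝟐 𝟑 → e₂₃ ; 𝟏 𝟑 → e₁₃
  ; 𝟐 𝟏 → ξ-flip Ξ 𝟏 𝟐 π₁₂ e₁₂ ; 𝟑 𝟐 → ξ-flip Ξ 𝟐 𝟑 π₂₃ e₂₃ ; 𝟑 𝟏 → ξ-flip Ξ 𝟏 𝟑 π₁₃ e₁₃
  }

-- The arguments are `ξ(1,2)`, `ξ(2,3)`, `ξ(1,3)` in this order; the inverses in cases (iv), (v) and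
-- (x) come from prescribed values `ξ(3,1)` or `ξ(3,2)`.
canonical : Case → Perspectives
canonical ⟨i⟩    = perspectives ρ ρ ρ
canonical ⟨ii⟩   = perspectives ρ ρ id𝒯
canonical ⟨iii⟩  = perspectives ρ id𝒯 id𝒯
canonical ⟨iv⟩   = perspectives ρ ρ (ρ ⁻¹𝒯)
canonical ⟨v⟩    = perspectives ρ (ρ ⁻¹𝒯) id𝒯
canonical ⟨vi⟩   = perspectives (σ a) (σ b) (σ c)
canonical ⟨vii⟩  = perspectives (σ a) (σ c) id𝒯
canonical ⟨viii⟩ = perspectives (σ a) ρ id𝒯
canonical ⟨ix⟩   = perspectives (σ a) (σ c) ρ
canonical ⟨x⟩    = perspectives (σ a) (σ c) (ρ ⁻¹𝒯)
canonical ⟨xi⟩   = perspectives (σ c) (σ c) (σ a)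
canonical ⟨xii⟩  = perspectives (σ c) (σ c) ρ
canonical ⟨xiii⟩ = perspectives ρ ρ (σ c)
canonical ⟨xiv⟩  = perspectives ρ (ρ ⁻¹𝒯) (σ c)

≈-canonical : ∀ κ Ξ → IsCase κ Ξ → Ξ ≈ₚ canonical κ
≈-canonical ⟨i⟩    Ξ (e₁₂ , e₂₃ , e₁₃) = ≈-perspectives Ξ e₁₂ e₂₃ e₁₃
≈-canonical ⟨ii⟩   Ξ (e₁₂ , e₂₃ , e₁₃) = ≈-perspectives Ξ e₁₂ e₂₃ e₁₃
≈-canonical ⟨iii⟩  Ξ (e₁₂ , e₁₃ , e₂₃) = ≈-perspectives Ξ e₁₂ e₂₃ e₁₃
≈-canonical ⟨iv⟩   Ξ (e₁₂ , e₂₃ , e₃₁) = ≈-perspectives Ξ e₁₂ e₂₃ (ξ-flip Ξ 𝟑 𝟏 ρ e₃₁)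
≈-canonical ⟨v⟩    Ξ (e₁₂ , e₃₂ , e₁₃) = ≈-perspectives Ξ e₁₂ (ξ-flip Ξ 𝟑 𝟐 ρ e₃₂) e₁₃
≈-canonical ⟨vi⟩   Ξ (e₁₂ , e₁₃ , e₂₃) = ≈-perspectives Ξ e₁₂ e₂₃ e₁₃
≈-canonical ⟨vii⟩  Ξ (e₁₂ , e₂₃ , e₁₃) = ≈-perspectives Ξ e₁₂ e₂₃ e₁₃
≈-canonical ⟨viii⟩ Ξ (e₁₂ , e₂₃ , e₁₃) = ≈-perspectives Ξ e₁₂ e₂₃ e₁₃
≈-canonical ⟨ix⟩   Ξ (e₁₂ , e₂₃ , e₁₃) = ≈-perspectives Ξ e₁₂ e₂₃ e₁₃
≈-canonical ⟨x⟩    Ξ (e₁₂ , e₂₃ , e₃₁) = ≈-perspectives Ξ e₁₂ e₂₃ (ξ-flip Ξ 𝟑 𝟏 ρ e₃₁)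
≈-canonical ⟨xi⟩   Ξ (e₁₂ , e₂₃ , e₁₃) = ≈-perspectives Ξ e₁₂ e₂₃ e₁₃
≈-canonical ⟨xii⟩  Ξ (e₁₂ , e₂₃ , e₁₃) = ≈-perspectives Ξ e₁₂ e₂₃ e₁₃
≈-canonical ⟨xiii⟩ Ξ (e₁₂ , e₂₃ , e₁₃) = ≈-perspectives Ξ e₁₂ e₂₃ e₁₃
≈-canonical ⟨xiv⟩  Ξ (e₁₂ , e₂₃ , e₁₃) = ≈-perspectives Ξ e₁₂ e₂₃ e₁₃

infixr 9 _^𝒯_ _^I_

_^𝒯_ : ∀ {n} → Perm𝒯 → Fin n → Perm𝒯
β ^𝒯 m = power S𝒯 β (toℕ m)

_^I_ : ∀ {n} → PermI → Fin n → PermI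
α ^I m = power SI α (toℕ m)

-- The rotation stands on the left: in `(n h)(n′ h′) = n (h n′ h⁻¹) h h′` the reflection `σ c`
-- inverts `ρ`, in agreement with the product of `C₂⋉ C₃`.
dihedral-𝒯 : Fin 2 × Fin 3 → Perm𝒯
dihedral-𝒯 (s , m) = ρ ^𝒯 m ↔-∘ σ c ^𝒯 s

-- The bijection a, b, c ↦ 3, 1, 2 carries ρ to ϱ and σ c to σI 𝟐, hence σ x to
-- the σI i paired with it in case (vi).
dihedral-I : Fin 2 × Fin 3 → PermI
dihedral-I (s , m) = ϱ ^I m ↔-∘ σI 𝟐 ^I s

dihedral : (Fin 2 × Fin 3 → PermI) → Representation
dihedral on-I = record
  { group  = C₂⋉ C₃
  ; finite = ×-finite (Fin-finite 2) (Fin-finite 3)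
  ; ≈⇒≡    = λ { (refl , refl) → refl }
  ; on-𝒯   = dihedral-𝒯
  ; on-I   = on-I
  }

-- The action on `I` alone is faithful, so `β` may be the identity, as in cases (xi) and (xiv).
involutive : Perm𝒯 → Representation
involutive β = record
  { group  = AbelianGroup.group C₂
  ; finite = Fin-finite 2
  ; ≈⇒≡    = id
  ; on-𝒯   = β ^𝒯_
  ; on-I   = σI 𝟐 ^I_
  }

representation : Case → Representation
representation ⟨i⟩    = dihedral λ (s , _) → σI 𝟐 ^I s
representation ⟨ii⟩   = dihedral λ (s , _) → σI 𝟐 ^I s
representation ⟨iii⟩  = dihedral λ (s , _) → σI 𝟑 ^I s
representation ⟨iv⟩   = record
  { group  = C₂⋉ (C₃ ⊞ C₃)
  ; finite = ×-finite (Fin-finite 2) (×-finite (Fin-finite 3) (Fin-finite 3))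
  ; ≈⇒≡    = λ { (refl , refl , refl) → refl }
  -- Both actions share `s`, so the generator of `C₂` inverts both copies of `C₃` at once.
  ; on-𝒯   = λ (s , m , n) → dihedral-𝒯 (s , m)
  ; on-I   = λ (s , m , n) → dihedral-I (s , n)
  }
representation ⟨v⟩    = record
  { group  = AbelianGroup.group (C₂ ⊞ C₃)
  ; finite = ×-finite (Fin-finite 2) (Fin-finite 3)
  ; ≈⇒≡    = λ { (refl , refl) → refl }
  ; on-𝒯   = λ (s , m) → ρ ^𝒯 m
  ; on-I   = λ (s , m) → σI 𝟐 ^I s
  }
representation ⟨vi⟩   = dihedral dihedral-I
representation ⟨vii⟩  = involutive (σ b)
representation ⟨viii⟩ = record
  { group  = AbelianGroup.group (C 1)
  ; finite = Fin-finite 1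
  ; ≈⇒≡    = id
  ; on-𝒯   = λ _ → id𝒯
  ; on-I   = λ _ → idI
  }
representation ⟨ix⟩   = involutive (σ b)
representation ⟨x⟩    = involutive (σ b)
representation ⟨xi⟩   = involutive id𝒯
representation ⟨xii⟩  = involutive (σ c)
representation ⟨xiii⟩ = involutive (σ c)
representation ⟨xiv⟩  = involutive id𝒯

-- Here the whole search is evaluated, once for each case; the case is split because the decision
-- procedure reduces only for a concrete system.
isFullAutomorphismGroup : ∀ κ → IsFullAutomorphismGroup (canonical κ) (representation κ)
isFullAutomorphismGroup κ = witness (isFullAutomorphismGroup? (canonical κ) (representation κ)) (computed κ)
  where
  computed : ∀ κ → does (isFullAutomorphismGroup? (canonical κ) (representation κ)) ≡ true
  computed ⟨i⟩    = refl
  computed ⟨ii⟩   = refl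
  computed ⟨iii⟩  = refl
  computed ⟨iv⟩   = refl
  computed ⟨v⟩    = refl
  computed ⟨vi⟩   = refl
  computed ⟨vii⟩  = refl
  computed ⟨viii⟩ = refl
  computed ⟨ix⟩   = refl
  computed ⟨x⟩    = refl
  computed ⟨xi⟩   = refl
  computed ⟨xii⟩  = refl
  computed ⟨xiii⟩ = refl
  computed ⟨xiv⟩  = refl

-- Listed maps as elements of the representations

ρ-power : ∀ {β} → P β → ∃ λ (m : Fin 3) → ρ ^𝒯 m ≈𝒯 β
ρ-power = generated⇒power S𝒯 ρ (witness
  (forall? (Fin-finite 3) λ m → forall? (Fin-finite 3) λ n →
    forall? 𝒯-finite λ x → _≟_ 𝒯-finite _ _)
  refl)

ϱ-power : ∀ {α} → R α → ∃ λ (m : Fin 3) → ϱ ^I m ≈I α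
ϱ-power = generated⇒power SI ϱ (witness
  (forall? (Fin-finite 3) λ m → forall? (Fin-finite 3) λ n →
    forall? I-finite λ i → _≟_ I-finite _ _)
  refl)

rotation-∈P : ∀ m → P (dihedral-𝒯 (0F , m))
rotation-∈P m = respects (λ _ → refl) (power-generated S𝒯 ρ (toℕ m))

rotation-∈R : ∀ m → R (dihedral-I (0F , m))
rotation-∈R m = respects (λ _ → refl) (power-generated SI ϱ (toℕ m))

-- The composites of `σ c` with `ρ⁰`, `ρ¹`, `ρ²` on the left fix `c`, `b`, `a` respectively.
reflection-σ : ∀ m → ∃ λ x → dihedral-𝒯 (1F , m) ≈𝒯 σ x
reflection-σ 0F = c , each𝒯 refl refl refl
reflection-σ 1F = b , each𝒯 refl refl refl
reflection-σ 2F = a , each𝒯 refl refl refl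

σ-reflection : ∀ x → ∃ λ m → σ x ≈𝒯 dihedral-𝒯 (1F , m)
σ-reflection a = 2F , each𝒯 refl refl refl
σ-reflection b = 1F , each𝒯 refl refl refl
σ-reflection c = 0F , each𝒯 refl refl refl

reflection-σI : ∀ m → ∃ λ i → dihedral-I (1F , m) ≈I σI i
reflection-σI 0F = 𝟐 , eachI refl refl refl
reflection-σI 1F = 𝟏 , eachI refl refl refl
reflection-σI 2F = 𝟑 , eachI refl refl refl

σI-reflection : ∀ i → ∃ λ m → σI i ≈I dihedral-I (1F , m)
σI-reflection 𝟏 = 1F , eachI refl refl refl
σI-reflection 𝟐 = 0F , eachI refl refl refl
σI-reflection 𝟑 = 2F , eachI refl refl refl

open Representation

-- With `listed⇒on-points` this identifies the list of each case with the image of its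
-- representation, up to pointwise equality.
on-points-listed : ∀ κ g →
  Listed κ (on-I (representation κ) g) (on-𝒯 (representation κ) g)
on-points-listed ⟨i⟩ (0F , m) = inj₁ ((λ _ → refl) , rotation-∈P m)
on-points-listed ⟨i⟩ (1F , m) = inj₂ ((λ _ → refl) , reflection-σ m)
on-points-listed ⟨ii⟩ (0F , m) = inj₁ ((λ _ → refl) , rotation-∈P m)
on-points-listed ⟨ii⟩ (1F , m) = inj₂ ((λ _ → refl) , reflection-σ m)
on-points-listed ⟨iii⟩ (0F , m) = inj₁ ((λ _ → refl) , rotation-∈P m)
on-points-listed ⟨iii⟩ (1F , m) = inj₂ ((λ _ → refl) , reflection-σ m)
on-points-listed ⟨iv⟩ (0F , m , n) = inj₁ (rotation-∈R n , rotation-∈P m)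
on-points-listed ⟨iv⟩ (1F , m , n) =
  let i , α≈ = reflection-σI n ; x , β≈ = reflection-σ m in inj₂ (i , x , α≈ , β≈)
on-points-listed ⟨v⟩ (0F , m) = inj₁ (λ _ → refl) , power-generated S𝒯 ρ (toℕ m)
on-points-listed ⟨v⟩ (1F , m) = inj₂ (λ _ → refl) , power-generated S𝒯 ρ (toℕ m)
on-points-listed ⟨vi⟩ (0F , m)  = inj₁ (m , (λ _ → refl) , λ _ → refl)
-- The reflections with `m = 0, 1, 2` are the pairs `(c,2)`, `(b,1)`, `(a,3)`, which the list has in
-- another order.
on-points-listed ⟨vi⟩ (1F , 0F) =
  inj₂ (inj₂ (inj₁ (eachI refl refl refl , each𝒯 refl refl refl)))
on-points-listed ⟨vi⟩ (1F , 1F) =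
  inj₂ (inj₁ (eachI refl refl refl , each𝒯 refl refl refl))
on-points-listed ⟨vi⟩ (1F , 2F) =
  inj₂ (inj₂ (inj₂ (eachI refl refl refl , each𝒯 refl refl refl)))
on-points-listed ⟨vii⟩ 0F = inj₁ ((λ _ → refl) , λ _ → refl)
on-points-listed ⟨vii⟩ 1F = inj₂ ((λ _ → refl) , λ _ → refl)
on-points-listed ⟨viii⟩ 0F = (λ _ → refl) , λ _ → refl
on-points-listed ⟨ix⟩ 0F = inj₁ ((λ _ → refl) , λ _ → refl)
on-points-listed ⟨ix⟩ 1F = inj₂ ((λ _ → refl) , λ _ → refl)
on-points-listed ⟨x⟩ 0F = inj₁ ((λ _ → refl) , λ _ → refl)
on-points-listed ⟨x⟩ 1F = inj₂ ((λ _ → refl) , λ _ → refl)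
on-points-listed ⟨xi⟩ 0F = inj₁ (λ _ → refl) , λ _ → refl
on-points-listed ⟨xi⟩ 1F = inj₂ (λ _ → refl) , λ _ → refl
on-points-listed ⟨xii⟩ 0F = inj₁ ((λ _ → refl) , λ _ → refl)
on-points-listed ⟨xii⟩ 1F = inj₂ ((λ _ → refl) , λ _ → refl)
on-points-listed ⟨xiii⟩ 0F = inj₁ ((λ _ → refl) , λ _ → refl)
on-points-listed ⟨xiii⟩ 1F = inj₂ ((λ _ → refl) , λ _ → refl)
on-points-listed ⟨xiv⟩ 0F = inj₁ (λ _ → refl) , λ _ → refl
on-points-listed ⟨xiv⟩ 1F = inj₂ (λ _ → refl) , λ _ → refl

listed⇒on-points : ∀ κ {α β} → Listed κ α β →
  ∃ λ g → α ≈I on-I (representation κ) g × β ≈𝒯 on-𝒯 (representation κ) g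
listed⇒on-points ⟨i⟩ (inj₁ (α≈ , β∈P)) =
  let m , e = ρ-power β∈P in (0F , m) , α≈ , λ x → sym (e x)
listed⇒on-points ⟨i⟩ (inj₂ (α≈ , x , β≈)) =
  let m , e = σ-reflection x in (1F , m) , α≈ , λ y → trans (β≈ y) (e y)
listed⇒on-points ⟨ii⟩ (inj₁ (α≈ , β∈P)) =
  let m , e = ρ-power β∈P in (0F , m) , α≈ , λ x → sym (e x)
listed⇒on-points ⟨ii⟩ (inj₂ (α≈ , x , β≈)) =
  let m , e = σ-reflection x in (1F , m) , α≈ , λ y → trans (β≈ y) (e y)
listed⇒on-points ⟨iii⟩ (inj₁ (α≈ , β∈P)) =
  let m , e = ρ-power β∈P in (0F , m) , α≈ , λ x → sym (e x)
listed⇒on-points ⟨iii⟩ (inj₂ (α≈ , x , β≈)) =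
  let m , e = σ-reflection x in (1F , m) , α≈ , λ y → trans (β≈ y) (e y)
listed⇒on-points ⟨iv⟩ (inj₁ (α∈R , β∈P)) =
  let n , d = ϱ-power α∈R ; m , e = ρ-power β∈P in
  (0F , m , n) , (λ i → sym (d i)) , λ x → sym (e x)
listed⇒on-points ⟨iv⟩ (inj₂ (i , x , α≈ , β≈)) =
  let n , d = σI-reflection i ; m , e = σ-reflection x in
  (1F , m , n) , (λ j → trans (α≈ j) (d j)) , λ y → trans (β≈ y) (e y)
listed⇒on-points ⟨v⟩ (inj₁ α≈ , β∈P) =
  let m , e = ρ-power β∈P in (0F , m) , α≈ , λ x → sym (e x)
listed⇒on-points ⟨v⟩ (inj₂ α≈ , β∈P) =
  let m , e = ρ-power β∈P in (1F , m) , α≈ , λ x → sym (e x)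
listed⇒on-points ⟨vi⟩ (inj₁ (m , α≈ , β≈)) = (0F , m) , α≈ , β≈
listed⇒on-points ⟨vi⟩ (inj₂ (inj₁ (α≈ , β≈))) =
  (1F , 1F) , (λ j → trans (α≈ j) (proj₂ (σI-reflection 𝟏) j))
            , λ y → trans (β≈ y) (proj₂ (σ-reflection b) y)
listed⇒on-points ⟨vi⟩ (inj₂ (inj₂ (inj₁ (α≈ , β≈)))) =
  (1F , 0F) , (λ j → trans (α≈ j) (proj₂ (σI-reflection 𝟐) j))
            , λ y → trans (β≈ y) (proj₂ (σ-reflection c) y)
listed⇒on-points ⟨vi⟩ (inj₂ (inj₂ (inj₂ (α≈ , β≈)))) =
  (1F , 2F) , (λ j → trans (α≈ j) (proj₂ (σI-reflection 𝟑) j))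
            , λ y → trans (β≈ y) (proj₂ (σ-reflection a) y)
listed⇒on-points ⟨vii⟩ (inj₁ (α≈ , β≈)) = 0F , α≈ , β≈
listed⇒on-points ⟨vii⟩ (inj₂ (α≈ , β≈)) = 1F , α≈ , β≈
listed⇒on-points ⟨viii⟩ (α≈ , β≈) = 0F , α≈ , β≈
listed⇒on-points ⟨ix⟩ (inj₁ (α≈ , β≈)) = 0F , α≈ , β≈
listed⇒on-points ⟨ix⟩ (inj₂ (α≈ , β≈)) = 1F , α≈ , β≈
listed⇒on-points ⟨x⟩ (inj₁ (α≈ , β≈)) = 0F , α≈ , β≈
listed⇒on-points ⟨x⟩ (inj₂ (α≈ , β≈)) = 1F , α≈ , β≈
listed⇒on-points ⟨xi⟩ (inj₁ α≈ , β≈) = 0F , α≈ , β≈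
listed⇒on-points ⟨xi⟩ (inj₂ α≈ , β≈) = 1F , α≈ , β≈
listed⇒on-points ⟨xii⟩ (inj₁ (α≈ , β≈)) = 0F , α≈ , β≈
listed⇒on-points ⟨xii⟩ (inj₂ (α≈ , β≈)) = 1F , α≈ , β≈
listed⇒on-points ⟨xiii⟩ (inj₁ (α≈ , β≈)) = 0F , α≈ , β≈
listed⇒on-points ⟨xiii⟩ (inj₂ (α≈ , β≈)) = 1F , α≈ , β≈
listed⇒on-points ⟨xiv⟩ (inj₁ α≈ , β≈) = 0F , α≈ , β≈
listed⇒on-points ⟨xiv⟩ (inj₂ α≈ , β≈) = 1F , α≈ , β≈

⊠-cong : ∀ {β β′ α α′} → β ≈𝒯 β′ → α ≈I α′ → ∀ p → to (β ⊠ α) p ≡ to (β′ ⊠ α′) p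
⊠-cong {β} {β′} {α} {α′} β≈ α≈ = λ
  { (q^ x)   → cong q^ (β≈ x)
  ; (x at i) → cong₂ _at_ (β≈ x) (α≈ i)
  ; q₁₂      → q-cong (α≈ 𝟏) (α≈ 𝟐) _ _
  ; q₁₃      → q-cong (α≈ 𝟏) (α≈ 𝟑) _ _
  ; q₂₃      → q-cong (α≈ 𝟐) (α≈ 𝟑) _ _
  }
  where
  q-cong : ∀ {i i′ j j′} → i ≡ i′ → j ≡ j′ →
           .(i≢j : i ≢ j) .(i′≢j′ : i′ ≢ j′) → q i j i≢j ≡ q i′ j′ i′≢j′
  q-cong refl refl _ _ = refl

-- Isomorphism types

dihedral≅SI : C₂⋉ C₃ ≅ SI
dihedral≅SI = mk-≅ {C₂⋉ C₃} {SI} dihedral-I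
  (λ { {g} (refl , refl) → SI.refl {dihedral-I g} })
  (witness (forall? D λ g → forall? D λ h → forall? I-finite λ i → _≟_ I-finite _ _) refl)
  (λ {g} {h} e → D₆.reflexive (witness
    (forall? D λ g → forall? D λ h →
      (forall? I-finite λ i → _≟_ I-finite (to (dihedral-I g) i) (to (dihedral-I h) i))
        →-dec _≟_ D g h)
    refl g h e))
  (λ α → let g , e₁ , e₂ , e₃ = find (to α 𝟏) (to α 𝟐) (to α 𝟑)
               ((λ ()) ∘ ↔-injective α) ((λ ()) ∘ ↔-injective α) ((λ ()) ∘ ↔-injective α)
         in g , eachI e₁ e₂ e₃)
  where
  module SI = Group SI
  module D₆ = Group (C₂⋉ C₃)
  D = ×-finite (Fin-finite 2) (Fin-finite 3)
  -- For surjectivity: a permutation of `I` is determined by its three distinct values, and all such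
  -- triples can be run through by evaluation.
  find : ∀ i j k → i ≢ j → i ≢ k → j ≢ k → ∃ λ g →
    to (dihedral-I g) 𝟏 ≡ i × to (dihedral-I g) 𝟐 ≡ j × to (dihedral-I g) 𝟑 ≡ k
  find = witness
    (forall? I-finite λ i → forall? I-finite λ j → forall? I-finite λ k →
      ¬? (_≟_ I-finite i j) →-dec (¬? (_≟_ I-finite i k) →-dec (¬? (_≟_ I-finite j k) →-dec
      exists? D λ g → _≟_ I-finite _ i ×-dec _≟_ I-finite _ j ×-dec _≟_ I-finite _ k)))
    refl

S𝒯≅SI : S𝒯 ≅ SI
S𝒯≅SI = Sym-cong (mk↔ₛ′ (each𝒯 𝟏 𝟐 𝟑) (eachI a b c) (eachI refl refl refl) (each𝒯 refl refl refl))

isomorphismType : ∀ κ {𝔊} → 𝔊 ≅ group (representation κ) → IsomorphismType κ 𝔊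
isomorphismType ⟨i⟩    iso = iso , dihedral≅SI
isomorphismType ⟨ii⟩   iso = iso , dihedral≅SI
isomorphismType ⟨iii⟩  iso = iso , dihedral≅SI
isomorphismType ⟨iv⟩   iso = iso
isomorphismType ⟨v⟩    iso = iso
-- The representation gives `C₂⋉ C₃`, which is carried to `S𝒯` by way of `SI`.
isomorphismType ⟨vi⟩ {𝔊} iso =
    ≅-trans {𝔊} {SI} {S𝒯} (≅-trans {𝔊} {C₂⋉ C₃} {SI} iso dihedral≅SI) (≅-sym {S𝒯} {SI} S𝒯≅SI)
  , S𝒯≅SI
isomorphismType ⟨vii⟩  iso = iso
isomorphismType ⟨viii⟩ iso = _
isomorphismType ⟨ix⟩   iso = iso
isomorphismType ⟨x⟩    iso = iso
isomorphismType ⟨xi⟩   iso = iso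
isomorphismType ⟨xii⟩  iso = iso
isomorphismType ⟨xiii⟩ iso = iso
isomorphismType ⟨xiv⟩  iso = iso

proposition2p14 : (κ : Case) (Ξ : Perspectives) → IsCase κ Ξ →
    ((f : TPPoint ↔ TPPoint) →
    IsAutomorphism (TP Ξ) f ⇔
    (∃₂ λ α β → Listed κ α β × Group._≈_ (Sym TPPoint) f (β ⊠ α)))
    × IsomorphismType κ (Aut (TP Ξ))
proposition2p14 κ Ξ isCase = (λ f → mk⇔ (listed f) (automorphism f)) , isomorphismType κ Aut-≅
  where
  V = representation κ
  open FullAutomorphismGroup (isFullAutomorphismGroup κ) {Ξ} (≈-canonical κ Ξ isCase)

  listed : ∀ f → IsAutomorphism (TP Ξ) f →
           ∃₂ λ α β → Listed κ α β × (∀ p → to f p ≡ to (β ⊠ α) p)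
  listed f F = let g , e = automorphism⇒on-points f F in
    on-I V g , on-𝒯 V g , on-points-listed κ g , λ p → sym (e p)

  automorphism : ∀ f → (∃₂ λ α β → Listed κ α β × (∀ p → to f p ≡ to (β ⊠ α) p)) →
                 IsAutomorphism (TP Ξ) f
  automorphism f (α , β , listed , f≈) =
    let g , α≈ , β≈ = listed⇒on-points κ listed in
    -- `f` agrees with the map of `g` only pointwise, so the automorphism property is transported.
    automorphism-cong (TP Ξ) {on-points V g} {f}
      (λ p → sym (trans (f≈ p) (⊠-cong {β} {on-𝒯 V g} {α} {on-I V g} β≈ α≈ p)))
      (on-points-automorphism g)
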